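{- The online algorithm $\textsc{Move-Half}$ is dynamically optimal, i.e., there is a constant $c$ such that for every request sequence $\sigma$, $\mathrm{cost}(\textsc{Move-Half}(\sigma)) \le c\cdot \mathrm{cost}(\textsc{Opt}(\sigma))$.
   Context: Self-adjusting complete tree model: a set $V$ of $n$ items is stored in a complete binary tree of $n$ servers, one item per server; the root has depth $0$ and an item's depth is that of its hosting server. Requests $\sigma=(\sigma^{(1)},\sigma^{(2)},\dots)$ to items are revealed online and originate at the root. Serving a request to an item at depth $d$ costs $d$ (access cost); a swap, exchanging the items of a server and its parent, costs $1$ (adjustment cost); the cost of an algorithm on $\sigma$ is the total of access and adjustment costs. Two items $u,v$ can be interchanged (all other items stay in place) by swapping $u$ along the tree path to $v$'s server and then $v$ back along the same path to $u$'s original server. $\textsc{Opt}$ denotes an optimal offline algorithm that knows $\sigma$ in advance. The rank of an item $v$ at time $t$ is the number of distinct items requested since the last request of $v$ before $t$, including $v$. Algorithm $\textsc{Move-Half}$: it starts from the same tree as $\textsc{Opt}$, assumed to be an MRU tree (every item $v$ has depth $\lfloor \log_2 v.\mathrm{rank}\rfloor$). Upon a request to item $u$ at depth $d$, it accesses $u$ (cost $d$), lets $v$ be the item of highest rank among the items at depth $\lfloor d/2\rfloor$, and interchanges $u$ and $v$ via swaps along the tree path between them. -}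

module Defs where

open import Data.Nat.Base using (ℕ; zero; suc; _+_; _*_; _≤_; _≡ᵇ_; _<ᵇ_; ⌊_/2⌋)
open import Data.Nat.Logarithm using (⌊log₂_⌋)
open import Data.Fin.Base using (Fin)
open import Data.Fin.Properties using (_≟_)
open import Data.Bool.Base using (Bool; true; false; if_then_else_)
open import Data.List.Base using (List; []; _∷_; _++_; reverse; length; map; foldl)
open import Data.List.Relation.Unary.All as LAll using ()
open import Data.Vec.Base using (Vec; []; _∷_)
open import Data.Vec.Relation.Unary.All as VAll using ()
open import Data.Maybe.Base using (Maybe; just; nothing)
open import Data.Product.Base using (_×_; _,_)
open import Relation.Nullary.Decidable.Core using (does)
open import Relation.Binary.PropositionalEquality using (_≡_)

-- Complete binary tree of n servers, in heap numbering:
-- servers are the heap indices 1..n, root = 1, parent of h is ⌊h/2⌋,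
-- depth of server h is ⌊log₂ h⌋ (root has depth 0).

depth : ℕ → ℕ
depth h = ⌊log₂ h ⌋

-- A configuration: each item (Fin n) is mapped to its hosting server.
Config : ℕ → Set
Config n = Fin n → ℕ

ValidConfig : ∀ {n} → Config n → Set
ValidConfig {n} p = (∀ u → (1 ≤ p u) × (p u ≤ n)) × (∀ u v → p u ≡ p v → u ≡ v)

swapSrv : ∀ {n} → ℕ → ℕ → Config n → Config n
swapSrv a b p u = if p u ≡ᵇ a then b else (if p u ≡ᵇ b then a else p u)

applySwaps : ∀ {n} → List (ℕ × ℕ) → Config n → Config n
applySwaps sw p = foldl (λ q ab → swapSrv (Data.Product.Base.proj₁ ab) (Data.Product.Base.proj₂ ab) q) p sw
  where import Data.Product.Base

-- Tree path between heap indices i and j (both ≥ 1), listing servers from i to j.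
-- (The larger index is never an ancestor of the smaller, so moving it to its
-- parent always stays on the i–j path.)  The first argument is fuel.
treePath' : ℕ → ℕ → ℕ → List ℕ
treePath' zero i j = []
treePath' (suc f) i j =
  if i ≡ᵇ j then i ∷ []
  else (if j <ᵇ i then i ∷ treePath' f ⌊ i /2⌋ j
        else treePath' f i ⌊ j /2⌋ ++ (j ∷ []))

treePath : ℕ → ℕ → List ℕ
treePath i j = treePath' (suc (i + j)) i j

consecutive : List ℕ → List (ℕ × ℕ)
consecutive (x ∷ y ∷ r) = (x , y) ∷ consecutive (y ∷ r)
consecutive _ = []

-- Interchange of u (at server i) and v (at server j) along the path
-- x₀ = i, …, x_ℓ = j: swap u along the path to x_ℓ, then v back along the
-- same path (from x_{ℓ-1}) to x₀.  Each pair is a parent/child swap.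
interchangeSwaps : ℕ → ℕ → List (ℕ × ℕ)
interchangeSwaps i j = consecutive path ++ back (reverse path)
  where
  path = treePath i j
  back : List ℕ → List (ℕ × ℕ)
  back [] = []
  back (_ ∷ rest) = consecutive rest

-- Ranks: a recency list (most recently requested first) containing every
-- item once; rank of v = 1-based position of v in this list, i.e. the
-- number of distinct items requested since the last request of v, incl. v.

rankOf : ∀ {n} → List (Fin n) → Fin n → ℕ
rankOf [] u = 1
rankOf (x ∷ L) u = if does (x ≟ u) then 1 else suc (rankOf L u)

removeItem : ∀ {n} → Fin n → List (Fin n) → List (Fin n)
removeItem u [] = []
removeItem u (x ∷ L) = if does (x ≟ u) then removeItem u L else x ∷ removeItem u L

moveToFront : ∀ {n} → Fin n → List (Fin n) → List (Fin n)
moveToFront u L = u ∷ removeItem u L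

IsMRU : ∀ {n} → Config n → List (Fin n) → Set
IsMRU p L = ∀ u → depth (p u) ≡ ⌊log₂ (rankOf L u) ⌋

highestRankAt : ∀ {n} → Config n → ℕ → List (Fin n) → Maybe (Fin n)
highestRankAt p k [] = nothing
highestRankAt p k (x ∷ L) with highestRankAt p k L
... | just y = just y
... | nothing = if depth (p x) ≡ᵇ k then just x else nothing

mhSwaps : ∀ {n} → Config n → List (Fin n) → Fin n → List (ℕ × ℕ)
mhSwaps p L u with highestRankAt p ⌊ depth (p u) /2⌋ L
... | nothing = []
... | just v = interchangeSwaps (p u) (p v)

mhCost : ∀ {n} → Config n → List (Fin n) → List (Fin n) → ℕ
mhCost p L [] = 0
mhCost p L (u ∷ σ) =
  depth (p u) + length (mhSwaps p L u)
  + mhCost (applySwaps (mhSwaps p L u) p) (moveToFront u L) σ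

-- Arbitrary offline algorithm: before serving the t-th request it performs
-- a list of swaps, each given by a child server h (2 ≤ h ≤ n) swapped with
-- its parent ⌊h/2⌋; then it accesses the requested item.

ValidSwapList : ℕ → List ℕ → Set
ValidSwapList n s = LAll.All (λ h → (2 ≤ h) × (h ≤ n)) s

ValidSchedule : ∀ {m} → ℕ → Vec (List ℕ) m → Set
ValidSchedule n s = VAll.All (ValidSwapList n) s

offCost : ∀ {n} → Config n → (σ : List (Fin n)) → Vec (List ℕ) (length σ) → ℕ
offCost p [] [] = 0
offCost p (u ∷ σ) (s ∷ ss) =
  length s + depth (applySwaps (map (λ h → (h , ⌊ h /2⌋)) s) p u)
  + offCost (applySwaps (map (λ h → (h , ⌊ h /2⌋)) s) p) σ ss

{-# OPTIONS --safe #-}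
module Submission where

-- Both the cost of Move-Half and the cost of Opt are compared with the sum over all requests of
-- ⌊log₂ rank⌋.
--
-- Move-Half.  The potential is Σ_x max(0, depth x − 2 ⌊log₂ rank x⌋).  A full level k contains an
-- item of rank at least 2^k, so the item pushed down to depth d by a request is already close to
-- its rank, whereas the requested item has its depth halved; if d was larger than 2 ⌊log₂ rank⌋,
-- the drop of the potential pays for the request.
--
-- Opt.  Let W k be the number of requests to items of rank ≥ 2^k, and fix a level i with M = 2^(i+2).
-- The potential is the sum of min(M, max(0, rank x − M)) over the items that Opt keeps at depth ≤ i.
-- A request to such an item of rank ≥ 2 M releases M.  There are fewer than M/2 such items, so a
-- request of rank ≥ M raises the potential by at most M/2 and any other request does not raise it.
-- Hence 2 W (i+3) ≤ W (i+2) + 2 Y i, where Y i counts the requests Opt serves below depth i and its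
-- swaps across the boundary between levels i and i+1.  Since Σ_i Y i is at most the cost of Opt and
-- W 1 is at most twice that cost, summing over i bounds Σ_k W k, which is the sum of ⌊log₂ rank⌋.

open import Defs
open import Data.Bool.Base using (if_then_else_; true; false)
open import Data.Fin.Base as Fin using (Fin; toℕ; fromℕ<)
open import Data.Fin.Properties as Finₚ using (injective⇒≤; any?)
open import Data.List.Base using (List; []; _∷_; _++_; _∷ʳ_; [_]; reverse; length; map; foldl; allFin)
open import Data.List.Membership.Propositional using (_∈_)
open import Data.List.Membership.Propositional.Properties using (∈-allFin)
open import Data.List.Properties
  using (reverse-++; unfold-reverse; length-++; length-reverse; foldl-++; ++-assoc)
open import Data.List.Relation.Binary.Permutation.Propositional using (_↭_; ↭-sym; ↭⇒↭ₛ)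
open import Data.List.Relation.Binary.Permutation.Propositional.Properties using (∈-resp-↭)
import Data.List.Relation.Binary.Permutation.Setoid.Properties as PermutationSetoid
open import Data.List.Relation.Unary.All as All using (All; []; _∷_)
open import Data.List.Relation.Unary.All.Properties using (++⁺)
open import Data.List.Relation.Unary.AllPairs using ([]; _∷_)
open import Data.List.Relation.Unary.Any using (here; there)
open import Data.List.Relation.Unary.Unique.Propositional using (Unique)
open import Data.List.Relation.Unary.Unique.Propositional.Properties using (allFin⁺)
open import Data.Maybe.Base using (Maybe; just; nothing)
open import Data.Nat.Base
open import Data.Nat.Logarithm
open import Data.Nat.Properties
open import Data.Nat.Tactic.RingSolver using (solve-∀)
open import Data.Product.Base using (∃-syntax; _×_; _,_; proj₁; proj₂)
open import Data.Sum.Base using (_⊎_; inj₁; inj₂)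
open import Data.Vec.Base using (Vec; []; _∷_)
open import Data.Vec.Relation.Unary.All using ([]; _∷_)
open import Function.Base using (_∘_; const)
open import Algebra.Properties.CommutativeMonoid.Sum +-0-commutativeMonoid
  using (sum; ∑-distrib-+)
open import Relation.Binary.Definitions using (tri<; tri≈; tri>)
open import Relation.Binary.PropositionalEquality hiding ([_])
open import Relation.Nullary using (¬_; Dec; yes; no; does; contradiction)
open import Relation.Nullary.Decidable using (dec-true; dec-false)

-- Reduces a linear inequality to a semiring identity, with l ≤ r the sum of the hypotheses used.
linear : ∀ {l r a b} → l ≤ r → a + r ≡ b + l → a ≤ b
linear {l} {r} {a} {b} l≤r eq =
  +-cancelʳ-≤ r a b (subst (_≤ b + r) (sym eq) (+-monoʳ-≤ b l≤r))

-- Indicators and sums over items.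

𝟙 : ∀ {P : Set} → Dec P → ℕ
𝟙 d = if does d then 1 else 0

module _ {P : Set} where

  𝟙-yes : (d : Dec P) → P → 𝟙 d ≡ 1
  𝟙-yes (yes _) _ = refl
  𝟙-yes (no ¬p) p = contradiction p ¬p

  𝟙-no : (d : Dec P) → ¬ P → 𝟙 d ≡ 0
  𝟙-no (yes p) ¬p = contradiction p ¬p
  𝟙-no (no _)  _  = refl

  𝟙-≤ : (d : Dec P) {m : ℕ} → (P → 1 ≤ m) → 𝟙 d ≤ m
  𝟙-≤ (yes p) f = f p
  𝟙-≤ (no _)  f = z≤n

  𝟙*-≤ : (d : Dec P) {k m : ℕ} → (P → k ≤ m) → 𝟙 d * k ≤ m
  𝟙*-≤ (yes p) {k} f = subst (_≤ _) (sym (*-identityˡ k)) (f p)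
  𝟙*-≤ (no _)      f = z≤n

𝟙-mono : {P Q : Set} (d : Dec P) (e : Dec Q) → (P → Q) → 𝟙 d ≤ 𝟙 e
𝟙-mono d e f = 𝟙-≤ d (λ p → ≤-reflexive (sym (𝟙-yes e (f p))))

sum-mono : ∀ {n} {f g : Fin n → ℕ} → (∀ i → f i ≤ g i) → sum f ≤ sum g
sum-mono {zero}  f≤g = z≤n
sum-mono {suc n} f≤g = +-mono-≤ (f≤g Fin.zero) (sum-mono (f≤g ∘ Fin.suc))

sum-zero : ∀ {n} {f : Fin n → ℕ} → (∀ i → f i ≡ 0) → sum f ≡ 0
sum-zero {zero}  f≡0 = refl
sum-zero {suc n} f≡0 = cong₂ _+_ (f≡0 Fin.zero) (sum-zero (f≡0 ∘ Fin.suc))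

sum-mono₂ : ∀ {n} {f g f′ g′ : Fin n → ℕ} →
            (∀ i → f i + g i ≤ f′ i + g′ i) → sum f + sum g ≤ sum f′ + sum g′
sum-mono₂ {f = f} {g} {f′} {g′} le =
  subst₂ _≤_ (∑-distrib-+ f g) (∑-distrib-+ f′ g′) (sum-mono le)

sum-mono₃ : ∀ {n} {f g f′ g′ h′ : Fin n → ℕ} →
            (∀ i → f i + g i ≤ f′ i + (g′ i + h′ i)) →
            sum f + sum g ≤ sum f′ + (sum g′ + sum h′)
sum-mono₃ {f = f} {g} {f′} {g′} {h′} le =
  subst (λ z → sum f + sum g ≤ sum f′ + z) (∑-distrib-+ g′ h′) (sum-mono₂ {f = f} {g} {f′} le)

-- Spreads a term that concerns one item over all items, so that a change of potential can be proved
-- pointwise and then summed.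
δ : ∀ {n} → Fin n → ℕ → Fin n → ℕ
δ u c x = 𝟙 (x Finₚ.≟ u) * c

δ-≡ : ∀ {n} (u : Fin n) c → δ u c u ≡ c
δ-≡ u c = trans (cong (_* c) (𝟙-yes (u Finₚ.≟ u) refl)) (*-identityˡ c)

δ-≢ : ∀ {n} {x u : Fin n} c → x ≢ u → δ u c x ≡ 0
δ-≢ {x = x} {u} c x≢u = cong (_* c) (𝟙-no (x Finₚ.≟ u) x≢u)

sum-δ : ∀ {n} (u : Fin n) c → sum (δ u c) ≡ c
sum-δ {suc n} Fin.zero c = begin
  1 * c + sum {n} (const 0) ≡⟨ cong₂ _+_ (*-identityˡ c) (sum-zero {n} λ _ → refl) ⟩
  c + 0                     ≡⟨ +-identityʳ c ⟩
  c                         ∎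
  where open ≡-Reasoning
sum-δ (Fin.suc u) c = sum-δ u c

Injection : ∀ {n} → (Fin n → ℕ) → Set
Injection p = ∀ u v → p u ≡ p v → u ≡ v

-- Injectivity leaves at most one item on `s`: the sum is dominated by a single `δ`, or it vanishes.
sum-fibre-≤ : ∀ {n} {p : Fin n → ℕ} → Injection p → ∀ s k →
              sum (λ x → 𝟙 (p x ≟ s) * k) ≤ k
sum-fibre-≤ {p = p} inj s k with any? (λ u → p u ≟ s)
... | yes (u , pu≡s) = begin
  sum (λ x → 𝟙 (p x ≟ s) * k) ≤⟨ sum-mono (λ x → *-monoˡ-≤ k
                                   (𝟙-mono (p x ≟ s) (x Finₚ.≟ u)
                                     (λ px≡s → inj x u (trans px≡s (sym pu≡s))))) ⟩
  sum (δ u k)                 ≡⟨ sum-δ u k ⟩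
  k                           ∎
  where open ≤-Reasoning
... | no ∄u =
  ≤-trans (≤-reflexive (sum-zero λ x → cong (_* k) (𝟙-no (p x ≟ s) (λ e → ∄u (x , e))))) z≤n

sum-below-≤ : ∀ {n} {p : Fin n → ℕ} → Injection p → ∀ m k →
              sum (λ x → 𝟙 (p x <? m) * k) ≤ m * k
sum-below-≤ {p = p} inj zero    k =
  ≤-reflexive (sum-zero λ x → cong (_* k) (𝟙-no (p x <? 0) λ ()))
sum-below-≤ {p = p} inj (suc m) k = begin
  sum (λ x → 𝟙 (p x <? suc m) * k)
    ≤⟨ sum-mono (λ x → ≤-trans (*-monoˡ-≤ k (split x))
                         (≤-reflexive (*-distribʳ-+ k (𝟙 (p x ≟ m)) (𝟙 (p x <? m))))) ⟩
  sum (λ x → 𝟙 (p x ≟ m) * k + 𝟙 (p x <? m) * k)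
    ≡⟨ ∑-distrib-+ (λ x → 𝟙 (p x ≟ m) * k) (λ x → 𝟙 (p x <? m) * k) ⟩
  sum (λ x → 𝟙 (p x ≟ m) * k) + sum (λ x → 𝟙 (p x <? m) * k)
    ≤⟨ +-mono-≤ (sum-fibre-≤ inj m k) (sum-below-≤ inj m k) ⟩
  suc m * k ∎
  where
  open ≤-Reasoning
  split : ∀ x → 𝟙 (p x <? suc m) ≤ 𝟙 (p x ≟ m) + 𝟙 (p x <? m)
  split x = 𝟙-≤ (p x <? suc m) λ px<1+m → case-split (m<1+n⇒m<n∨m≡n px<1+m)
    where
    case-split : p x < m ⊎ p x ≡ m → 1 ≤ 𝟙 (p x ≟ m) + 𝟙 (p x <? m)
    case-split (inj₁ lt) = ≤-trans (≤-reflexive (sym (𝟙-yes (p x <? m) lt))) (m≤n+m _ _)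
    case-split (inj₂ eq) = ≤-trans (≤-reflexive (sym (𝟙-yes (p x ≟ m) eq))) (m≤m+n _ _)

-- Binary logarithms and depths

1≤2^ : ∀ k → 1 ≤ 2 ^ k
1≤2^ k = m^n>0 2 k

-- Induction on `k`, halving `r`: the logarithm of the half is smaller by one.
k≤log⇒2^k≤ : ∀ k {r} → 1 ≤ r → k ≤ ⌊log₂ r ⌋ → 2 ^ k ≤ r
k≤log⇒2^k≤ zero    1≤r _ = 1≤r
k≤log⇒2^k≤ (suc k) {suc zero} _ ()
k≤log⇒2^k≤ (suc k) {r@(suc (suc m))} _ k<log = begin
  2 * 2 ^ k             ≤⟨ *-monoʳ-≤ 2 (k≤log⇒2^k≤ k (s≤s z≤n) k≤) ⟩
  2 * ⌊ r /2⌋           ≡⟨ cong (⌊ r /2⌋ +_) (+-identityʳ _) ⟩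
  ⌊ r /2⌋ + ⌊ r /2⌋     ≤⟨ +-monoʳ-≤ ⌊ r /2⌋ (⌊n/2⌋≤⌈n/2⌉ r) ⟩
  ⌊ r /2⌋ + ⌈ r /2⌉     ≡⟨ ⌊n/2⌋+⌈n/2⌉≡n r ⟩
  r                     ∎
  where
  open ≤-Reasoning
  k≤ : k ≤ ⌊log₂ ⌊ r /2⌋ ⌋
  k≤ = subst (k ≤_) (sym (⌊log₂⌊n/2⌋⌋≡⌊log₂n⌋∸1 r)) (∸-monoˡ-≤ 1 k<log)

2^k≤⇒k≤log : ∀ k {r} → 2 ^ k ≤ r → k ≤ ⌊log₂ r ⌋
2^k≤⇒k≤log k {r} le = subst (_≤ ⌊log₂ r ⌋) (⌊log₂[2^n]⌋≡n k) (⌊log₂⌋-mono-≤ le)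

log≤⇒<2^ : ∀ k {r} → ⌊log₂ r ⌋ ≤ k → r < 2 ^ suc k
log≤⇒<2^ k {r} le = ≰⇒> λ 2^≤r → 1+n≰n (≤-trans (2^k≤⇒k≤log (suc k) 2^≤r) le)

depth≡0⇒≡1 : ∀ {h} → 1 ≤ h → depth h ≡ 0 → h ≡ 1
depth≡0⇒≡1 1≤h d≡0 = ≤-antisym (s≤s⁻¹ (log≤⇒<2^ 0 (≤-reflexive d≡0))) 1≤h

2≤⇒1≤depth : ∀ {h} → 2 ≤ h → 1 ≤ depth h
2≤⇒1≤depth = 2^k≤⇒k≤log 1

1≤half : ∀ {h} → 2 ≤ h → 1 ≤ ⌊ h /2⌋
1≤half = ⌊n/2⌋-mono

half<self : ∀ {h} → 1 ≤ h → ⌊ h /2⌋ < h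
half<self {suc h} _ = ⌊n/2⌋<n h

depth-half : ∀ {h} → 2 ≤ h → suc (depth ⌊ h /2⌋) ≡ depth h
depth-half {h} 2≤h = begin
  suc (depth ⌊ h /2⌋) ≡⟨ cong suc (⌊log₂⌊n/2⌋⌋≡⌊log₂n⌋∸1 h) ⟩
  suc (depth h ∸ 1)   ≡⟨ m+[n∸m]≡n (2≤⇒1≤depth 2≤h) ⟩
  depth h             ∎
  where open ≡-Reasoning

-- Swaps of two servers

τ : ℕ → ℕ → ℕ → ℕ
τ a b s = if s ≡ᵇ a then b else (if s ≡ᵇ b then a else s)

≡ᵇ-refl : ∀ a → (a ≡ᵇ a) ≡ true
≡ᵇ-refl a = dec-true (a ≟ a) refl

≢⇒≡ᵇ-false : ∀ {a b} → a ≢ b → (a ≡ᵇ b) ≡ false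
≢⇒≡ᵇ-false {a} {b} = dec-false (a ≟ b)

τ-left : ∀ a b → τ a b a ≡ b
τ-left a b rewrite ≡ᵇ-refl a = refl

τ-other : ∀ {a b s} → s ≢ a → s ≢ b → τ a b s ≡ s
τ-other s≢a s≢b rewrite ≢⇒≡ᵇ-false s≢a | ≢⇒≡ᵇ-false s≢b = refl

τ-right : ∀ a b → τ a b b ≡ a
τ-right a b with b ≟ a
... | yes refl = τ-left a a
... | no  b≢a rewrite ≢⇒≡ᵇ-false b≢a | ≡ᵇ-refl b = refl

data Position (a b s : ℕ) : Set where
  left  : s ≡ a → Position a b s
  right : s ≡ b → Position a b s
  other : s ≢ a → s ≢ b → Position a b s

position : ∀ a b s → Position a b s
position a b s with s ≟ a | s ≟ b
... | yes s≡a | _       = left s≡a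
... | no _    | yes s≡b = right s≡b
... | no s≢a  | no s≢b  = other s≢a s≢b

τ-involutive : ∀ a b s → τ a b (τ a b s) ≡ s
τ-involutive a b s with position a b s
... | left refl       = trans (cong (τ a b) (τ-left a b)) (τ-right a b)
... | right refl      = trans (cong (τ a b) (τ-right a b)) (τ-left a b)
... | other s≢a s≢b = trans (cong (τ a b) (τ-other s≢a s≢b)) (τ-other s≢a s≢b)

-- Conjugating a transposition by another renames its points. This is the induction step for walking
-- along a path and back.
τ-conjugate : ∀ {x x′ j} → x ≢ j → x′ ≢ j → ∀ s → τ x′ x (τ x′ j (τ x x′ s)) ≡ τ x j s
τ-conjugate {x} {x′} {j} x≢j x′≢j s with s ≟ j
... | yes refl rewrite τ-other {x} {x′} (≢-sym x≢j) (≢-sym x′≢j) | τ-right x′ j | τ-left x′ x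
                     | τ-right x j = refl
... | no s≢j with position x x′ s
... | left refl rewrite τ-left x x′ | τ-left x′ j | τ-left x j =
        τ-other (≢-sym x′≢j) (≢-sym x≢j)
... | other s≢x s≢x′ rewrite τ-other s≢x s≢x′ | τ-other s≢x′ s≢j | τ-other s≢x s≢j =
        τ-other s≢x′ s≢x
... | right refl with x ≟ x′
...   | yes refl rewrite τ-left x x =
        trans (cong (τ x x) (τ-left x j))
          (trans (τ-other (≢-sym x≢j) (≢-sym x≢j)) (sym (τ-left x j)))
...   | no x≢x′ rewrite τ-right x x′ | τ-other x≢x′ x≢j | τ-right x′ x =
        sym (τ-other (≢-sym x≢x′) s≢j)

Valid-swapSrv : ∀ {n a b} {p : Config n} → 1 ≤ a → a ≤ n → 1 ≤ b → b ≤ n →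
                ValidConfig p → ValidConfig (swapSrv a b p)
Valid-swapSrv {n} {a} {b} {p} 1≤a a≤n 1≤b b≤n (range , inj) = range′ , inj′
  where
  range′ : ∀ u → (1 ≤ τ a b (p u)) × (τ a b (p u) ≤ n)
  range′ u with position a b (p u)
  ... | left e rewrite e | τ-left a b = 1≤b , b≤n
  ... | right e rewrite e | τ-right a b = 1≤a , a≤n
  ... | other ≢a ≢b rewrite τ-other ≢a ≢b = range u
  inj′ : Injection (swapSrv a b p)
  inj′ u v e = inj u v (begin
    p u                   ≡⟨ τ-involutive a b (p u) ⟨
    τ a b (τ a b (p u))   ≡⟨ cong (τ a b) e ⟩
    τ a b (τ a b (p v))   ≡⟨ τ-involutive a b (p v) ⟩
    p v                   ∎)
    where open ≡-Reasoning

Valid-resp-≗ : ∀ {n} {p q : Config n} → p ≗ q → ValidConfig q → ValidConfig p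
Valid-resp-≗ {n} {p} {q} p≗q (range , inj) =
  (λ u → subst (λ s → (1 ≤ s) × (s ≤ n)) (sym (p≗q u)) (range u)) ,
  (λ u v e → inj u v (trans (sym (p≗q u)) (trans e (p≗q v))))

-- Interchanges

-- A swap list moves the contents of servers whatever the items are, so its effect can be computed
-- on servers alone.
act : List (ℕ × ℕ) → ℕ → ℕ
act sw s = foldl (λ z ab → τ (proj₁ ab) (proj₂ ab) z) s sw

applySwaps≗act : ∀ {n} (sw : List (ℕ × ℕ)) (p : Config n) → applySwaps sw p ≗ act sw ∘ p
applySwaps≗act []             p u = refl
applySwaps≗act ((a , b) ∷ sw) p u = applySwaps≗act sw (swapSrv a b p) u

act-++ : ∀ sw sw′ s → act (sw ++ sw′) s ≡ act sw′ (act sw s)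
act-++ sw sw′ s = foldl-++ _ s sw sw′

consecutive-∷ʳ : ∀ P x y → consecutive (P ∷ʳ x ∷ʳ y) ≡ consecutive (P ∷ʳ x) ∷ʳ (x , y)
consecutive-∷ʳ []          x y = refl
consecutive-∷ʳ (z ∷ [])    x y = refl
consecutive-∷ʳ (z ∷ w ∷ P) x y = cong ((z , w) ∷_) (consecutive-∷ʳ (w ∷ P) x y)

-- `P` is the path without its end `j`. The way back omits `j`, because the last swap forth has
-- already moved the item of `j` to the last server of `P`.
thereAndBack : List ℕ → ℕ → List (ℕ × ℕ)
thereAndBack P j = consecutive (P ∷ʳ j) ++ consecutive (reverse P)

thereAndBack-∷ : ∀ x x′ P j →
  thereAndBack (x ∷ x′ ∷ P) j ≡ (x , x′) ∷ thereAndBack (x′ ∷ P) j ++ [ (x′ , x) ]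
thereAndBack-∷ x x′ P j = cong ((x , x′) ∷_) (begin
  forth ++ consecutive (reverse (x ∷ x′ ∷ P))
    ≡⟨ cong (λ R → forth ++ consecutive R) (unfold-reverse x (x′ ∷ P)) ⟩
  forth ++ consecutive (reverse (x′ ∷ P) ∷ʳ x)
    ≡⟨ cong (λ R → forth ++ consecutive (R ∷ʳ x)) (unfold-reverse x′ P) ⟩
  forth ++ consecutive (reverse P ∷ʳ x′ ∷ʳ x)
    ≡⟨ cong (forth ++_) (consecutive-∷ʳ (reverse P) x′ x) ⟩
  forth ++ (consecutive (reverse P ∷ʳ x′) ∷ʳ (x′ , x))
    ≡⟨ cong (λ R → forth ++ (consecutive R ∷ʳ (x′ , x))) (unfold-reverse x′ P) ⟨
  forth ++ (consecutive (reverse (x′ ∷ P)) ∷ʳ (x′ , x))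
    ≡⟨ ++-assoc forth (consecutive (reverse (x′ ∷ P))) [ (x′ , x) ] ⟨
  thereAndBack (x′ ∷ P) j ++ [ (x′ , x) ] ∎)
  where
  open ≡-Reasoning
  forth = consecutive (x′ ∷ P ∷ʳ j)

-- Induction on the path: its first edge is swapped first and last, which conjugates the
-- transposition achieved by the rest of the path.
act-thereAndBack : ∀ x P j → All (_≢ j) (x ∷ P) → act (thereAndBack (x ∷ P) j) ≗ τ x j
act-thereAndBack x []       j _            s = refl
act-thereAndBack x (x′ ∷ P) j (x≢j ∷ x′∷P≢j@(x′≢j ∷ _)) s = begin
  act (thereAndBack (x ∷ x′ ∷ P) j) s
    ≡⟨ cong (λ sw → act sw s) (thereAndBack-∷ x x′ P j) ⟩
  act (thereAndBack (x′ ∷ P) j ++ [ (x′ , x) ]) (τ x x′ s)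
    ≡⟨ act-++ (thereAndBack (x′ ∷ P) j) [ (x′ , x) ] (τ x x′ s) ⟩
  τ x′ x (act (thereAndBack (x′ ∷ P) j) (τ x x′ s))
    ≡⟨ cong (τ x′ x) (act-thereAndBack x′ P j x′∷P≢j (τ x x′ s)) ⟩
  τ x′ x (τ x′ j (τ x x′ s))
    ≡⟨ τ-conjugate x≢j x′≢j s ⟩
  τ x j s ∎
  where open ≡-Reasoning

length-consecutive-∷ : ∀ x P → length (consecutive (x ∷ P)) ≡ length P
length-consecutive-∷ x []      = refl
length-consecutive-∷ x (y ∷ P) = cong suc (length-consecutive-∷ y P)

length-consecutive-≤ : ∀ P → length (consecutive P) ≤ length P
length-consecutive-≤ []      = z≤n
length-consecutive-≤ (x ∷ P) = ≤-trans (≤-reflexive (length-consecutive-∷ x P)) (n≤1+n _)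

length-thereAndBack : ∀ x P j →
  length (thereAndBack (x ∷ P) j) ≤ length (x ∷ P) + length (x ∷ P)
length-thereAndBack x P j = begin
  length (consecutive (x ∷ P ∷ʳ j) ++ consecutive (reverse (x ∷ P)))
    ≡⟨ length-++ (consecutive (x ∷ P ∷ʳ j)) ⟩
  length (consecutive (x ∷ P ∷ʳ j)) + length (consecutive (reverse (x ∷ P)))
    ≤⟨ +-mono-≤ (≤-reflexive (trans (length-consecutive-∷ x (P ∷ʳ j)) (length-++ P)))
                (length-consecutive-≤ (reverse (x ∷ P))) ⟩
  length P + 1 + length (reverse (x ∷ P))
    ≡⟨ cong₂ _+_ (+-comm (length P) 1) (length-reverse (x ∷ P)) ⟩
  length (x ∷ P) + length (x ∷ P) ∎
  where open ≤-Reasoning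

-- The bound by `i ⊔ j` is the invariant from which `down` derives that the earlier servers differ
-- from the new end `j`.
data PathShape (i j : ℕ) : List ℕ → Set where
  trivial : i ≡ j → PathShape i j [ j ]
  proper  : ∀ P → All (_≢ j) (i ∷ P) → All (_≤ i ⊔ j) (i ∷ P) →
            length (i ∷ P) ≤ depth i + depth j → PathShape i j (i ∷ P ∷ʳ j)

up : ∀ {i j P} → 1 ≤ j → j < i → PathShape ⌊ i /2⌋ j P → PathShape i j (i ∷ P)
up {i} {j} 1≤j j<i shape with ≤-<-trans 1≤j j<i
... | 2≤i with shape
...   | trivial _ = proper [] (>⇒≢ j<i ∷ []) (m≤m⊔n i j ∷ [])
                      (≤-trans (2≤⇒1≤depth 2≤i) (m≤m+n _ _))
...   | proper P P≢j P≤ len = proper (⌊ i /2⌋ ∷ P) (>⇒≢ j<i ∷ P≢j)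
        (m≤m⊔n i j ∷ All.map (λ le → ≤-trans le (⊔-monoˡ-≤ j (⌊n/2⌋≤n i))) P≤)
        (≤-trans (s≤s len) (≤-reflexive (cong (_+ depth j) (depth-half 2≤i))))

down : ∀ {i j P} → 1 ≤ i → i < j → PathShape i ⌊ j /2⌋ P → PathShape i j (P ∷ʳ j)
down {i} {j} 1≤i i<j shape with ≤-<-trans 1≤i i<j
... | 2≤j with shape
...   | trivial refl = proper [] (<⇒≢ i<j ∷ []) (m≤m⊔n _ j ∷ [])
                         (≤-trans (2≤⇒1≤depth 2≤j) (m≤n+m _ _))
...   | proper P _ P≤ len = proper (P ∷ʳ ⌊ j /2⌋)
        (All.map (λ le → <⇒≢ (≤-<-trans le i⊔half<j)) (++⁺ P≤ (m≤n⊔m i _ ∷ [])))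
        (All.map (λ le → ≤-trans le (⊔-monoʳ-≤ i (⌊n/2⌋≤n j))) (++⁺ P≤ (m≤n⊔m i _ ∷ [])))
        (begin
          suc (length (P ∷ʳ ⌊ j /2⌋))         ≡⟨ cong suc (trans (length-++ P) (+-comm (length P) 1)) ⟩
          suc (length (i ∷ P))                ≤⟨ s≤s len ⟩
          suc (depth i + depth ⌊ j /2⌋)       ≡⟨ +-suc (depth i) _ ⟨
          depth i + suc (depth ⌊ j /2⌋)       ≡⟨ cong (depth i +_) (depth-half 2≤j) ⟩
          depth i + depth j                   ∎)
  where
  open ≤-Reasoning
  i⊔half<j : i ⊔ ⌊ j /2⌋ < j
  i⊔half<j = ⊔-pres-<m i<j (half<self (≤-trans 1≤i (<⇒≤ i<j)))

-- Each step halves a positive index, so `i + j` decreases and the fuel suffices.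
treePath′-shape : ∀ f {i j} → 1 ≤ i → 1 ≤ j → i + j < f → PathShape i j (treePath' f i j)
treePath′-shape (suc f) {i} {j} 1≤i 1≤j i+j<f with <-cmp i j
... | tri≈ _ refl _ rewrite ≡ᵇ-refl i = trivial refl
... | tri> _ i≢j j<i rewrite ≢⇒≡ᵇ-false i≢j | dec-true (j <? i) j<i =
  up 1≤j j<i (treePath′-shape f (1≤half (≤-<-trans 1≤j j<i)) 1≤j
    (<-≤-trans (+-monoˡ-< j (half<self 1≤i)) (s≤s⁻¹ i+j<f)))
... | tri< i<j i≢j j≮i rewrite ≢⇒≡ᵇ-false i≢j | dec-false (j <? i) j≮i =
  down 1≤i i<j (treePath′-shape f 1≤i (1≤half (≤-<-trans 1≤i i<j))
    (<-≤-trans (+-monoʳ-< i (half<self 1≤j)) (s≤s⁻¹ i+j<f)))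

interchangeSwaps-∷ʳ : ∀ {i j P} → treePath i j ≡ P ∷ʳ j → interchangeSwaps i j ≡ thereAndBack P j
interchangeSwaps-∷ʳ {i} {j} {P} eq rewrite eq | reverse-++ P [ j ] = refl

Interchanges : ℕ → ℕ → List (ℕ × ℕ) → Set
Interchanges i j sw =
  act sw ≗ τ i j × length sw ≤ (depth i + depth j) + (depth i + depth j)

interchangeSwaps-correct : ∀ {i j} → 1 ≤ i → 1 ≤ j → Interchanges i j (interchangeSwaps i j)
interchangeSwaps-correct {i} {j} 1≤i 1≤j =
  from-shape (treePath i j) refl (treePath′-shape _ 1≤i 1≤j ≤-refl)
  where
  from-shape : ∀ P → treePath i j ≡ P → PathShape i j P → Interchanges i j (interchangeSwaps i j)
  from-shape _ eq (trivial refl) =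
    subst (Interchanges i i) (sym (interchangeSwaps-∷ʳ {i} {P = []} eq)) (τ-self , z≤n)
    where
    τ-self : ∀ s → s ≡ τ i i s
    τ-self s with s ≟ i
    ... | yes refl = sym (τ-left s s)
    ... | no s≢i   = sym (τ-other s≢i s≢i)
  from-shape _ eq (proper P P≢j _ len) =
    subst (Interchanges i j) (sym (interchangeSwaps-∷ʳ {i} {P = i ∷ P} eq))
      (act-thereAndBack i P j P≢j , ≤-trans (length-thereAndBack i P j) (+-mono-≤ len len))

-- Ranks

removeItem-∉ : ∀ {n} {u : Fin n} {L} → All (u ≢_) L → removeItem u L ≡ L
removeItem-∉ []          = refl
removeItem-∉ {u = u} {L = y ∷ L} (u≢y ∷ u≢L)
  rewrite dec-false (y Finₚ.≟ u) (≢-sym u≢y) = cong (y ∷_) (removeItem-∉ u≢L)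

All-removeItem : ∀ {n} {P : Fin n → Set} {u L} → All P L → All P (removeItem u L)
All-removeItem [] = []
All-removeItem {u = u} {L = y ∷ L} (py ∷ pL) with y Finₚ.≟ u
... | yes _ = All-removeItem pL
... | no _  = py ∷ All-removeItem pL

∉-removeItem : ∀ {n} (u : Fin n) L → All (u ≢_) (removeItem u L)
∉-removeItem u [] = []
∉-removeItem u (y ∷ L) with y Finₚ.≟ u
... | yes _   = ∉-removeItem u L
... | no  y≢u = ≢-sym y≢u ∷ ∉-removeItem u L

Unique-removeItem : ∀ {n} (u : Fin n) {L} → Unique L → Unique (removeItem u L)
Unique-removeItem u [] = []
Unique-removeItem u {y ∷ L} (y∉L ∷ uniq) with y Finₚ.≟ u
... | yes _ = Unique-removeItem u uniq
... | no _  = All-removeItem y∉L ∷ Unique-removeItem u uniq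

∈-removeItem : ∀ {n} {u x : Fin n} {L} → x ≢ u → x ∈ L → x ∈ removeItem u L
∈-removeItem {u = u} {L = y ∷ L} x≢u (here refl)
  rewrite dec-false (y Finₚ.≟ u) x≢u = here refl
∈-removeItem {u = u} {L = y ∷ L} x≢u (there x∈L) with y Finₚ.≟ u
... | yes _ = ∈-removeItem x≢u x∈L
... | no _  = there (∈-removeItem x≢u x∈L)

RecencyList : ∀ {n} → List (Fin n) → Set
RecencyList L = Unique L × (∀ u → u ∈ L)

RecencyList-moveToFront : ∀ {n} {L : List (Fin n)} u → RecencyList L → RecencyList (moveToFront u L)
RecencyList-moveToFront {L = L} u (uniq , complete) =
  ∉-removeItem u L ∷ Unique-removeItem u uniq , complete′
  where
  complete′ : ∀ x → x ∈ moveToFront u L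
  complete′ x with x Finₚ.≟ u
  ... | yes refl = here refl
  ... | no x≢u   = there (∈-removeItem x≢u (complete x))

1≤rank : ∀ {n} (L : List (Fin n)) x → 1 ≤ rankOf L x
1≤rank [] x = ≤-refl
1≤rank (y ∷ L) x with y Finₚ.≟ x
... | yes _ = ≤-refl
... | no _  = s≤s z≤n

rank-head : ∀ {n} (L : List (Fin n)) x → rankOf (x ∷ L) x ≡ 1
rank-head L x rewrite dec-true (x Finₚ.≟ x) refl = refl

rank-tail : ∀ {n} (L : List (Fin n)) {x y} → y ≢ x → rankOf (y ∷ L) x ≡ suc (rankOf L x)
rank-tail L {x} {y} y≢x rewrite dec-false (y Finₚ.≟ x) y≢x = refl

rank-injective : ∀ {n} {L : List (Fin n)} {x y} → x ∈ L → rankOf L x ≡ rankOf L y → x ≡ y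
rank-injective {L = z ∷ L} {x} {y} x∈ eq with z Finₚ.≟ x | z Finₚ.≟ y
rank-injective x∈ eq          | yes refl | yes refl = refl
rank-injective {L = z ∷ L} {y = y} x∈ eq | yes refl | no _ =
  contradiction (suc-injective eq) (<⇒≢ (1≤rank L y))
rank-injective {L = z ∷ L} {x} x∈ eq | no _ | yes refl =
  contradiction (sym (suc-injective eq)) (<⇒≢ (1≤rank L x))
rank-injective (here refl) eq | no z≢x | no _ = contradiction refl z≢x
rank-injective (there x∈L) eq | no _   | no _ = rank-injective x∈L (suc-injective eq)

rank-≤-removeItem : ∀ {n} {u x : Fin n} {L} → Unique L →
                    rankOf L x ≤ suc (rankOf (removeItem u L) x)
rank-≤-removeItem [] = n≤1+n 1
rank-≤-removeItem {u = u} {x} {y ∷ L} (y∉L ∷ uniq) with y Finₚ.≟ u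
... | yes refl rewrite removeItem-∉ y∉L with y Finₚ.≟ x
...   | yes _ = s≤s z≤n
...   | no _  = ≤-refl
rank-≤-removeItem {u = u} {x} {y ∷ L} (y∉L ∷ uniq) | no _ with y Finₚ.≟ x
...   | yes _ = s≤s z≤n
...   | no _  = s≤s (rank-≤-removeItem uniq)

rank-removeItem-≤ : ∀ {n} {u x : Fin n} L → x ≢ u → rankOf (removeItem u L) x ≤ rankOf L x
rank-removeItem-≤ [] x≢u = ≤-refl
rank-removeItem-≤ {u = u} {x} (y ∷ L) x≢u with y Finₚ.≟ u
... | yes refl rewrite dec-false (y Finₚ.≟ x) (≢-sym x≢u) = m≤n⇒m≤1+n (rank-removeItem-≤ L x≢u)
... | no _ with y Finₚ.≟ x
...   | yes _ = ≤-refl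
...   | no _  = s≤s (rank-removeItem-≤ L x≢u)

-- If `u` precedes `x`, its removal lowers the rank of `x`; otherwise `x` precedes `u` and its rank
-- is already smaller than that of `u`.
rank-removeItem-< : ∀ {n} {u x : Fin n} {L} → u ∈ L → x ≢ u →
  rankOf (removeItem u L) x < rankOf L x ⊎ rankOf (removeItem u L) x < rankOf L u
rank-removeItem-< {u = u} {x} {y ∷ L} u∈ x≢u with y Finₚ.≟ u
... | yes refl rewrite dec-false (y Finₚ.≟ x) (≢-sym x≢u) = inj₁ (s≤s (rank-removeItem-≤ L x≢u))
... | no y≢u with y Finₚ.≟ x
...   | yes refl = inj₂ (s≤s (1≤rank L u))
...   | no _ with u∈
...     | here refl = contradiction refl y≢u
...     | there u∈L with rank-removeItem-< u∈L x≢u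
...       | inj₁ lt = inj₁ (s≤s lt)
...       | inj₂ lt = inj₂ (s≤s lt)

module _ {n} {L : List (Fin n)} {u : Fin n} (recency : RecencyList L) where

  rank-moveToFront-≥2 : ∀ {x} → x ≢ u → 2 ≤ rankOf (moveToFront u L) x
  rank-moveToFront-≥2 {x} x≢u rewrite rank-tail (removeItem u L) (≢-sym x≢u) =
    s≤s (1≤rank (removeItem u L) x)

  rank-moveToFront-≥ : ∀ {x} → x ≢ u → rankOf L x ≤ rankOf (moveToFront u L) x
  rank-moveToFront-≥ x≢u rewrite rank-tail (removeItem u L) (≢-sym x≢u) =
    rank-≤-removeItem (proj₁ recency)

  rank-moveToFront-≤ : ∀ {x} → x ≢ u → rankOf (moveToFront u L) x ≤ suc (rankOf L x)
  rank-moveToFront-≤ x≢u rewrite rank-tail (removeItem u L) (≢-sym x≢u) =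
    s≤s (rank-removeItem-≤ L x≢u)

  -- A request can raise only ranks below that of the requested item, and never beyond it. Hence a
  -- request of rank below a threshold lifts no item across that threshold.
  rank-moveToFront-rises : ∀ {x} → x ≢ u →
    rankOf (moveToFront u L) x ≤ rankOf L x ⊎ rankOf (moveToFront u L) x ≤ rankOf L u
  rank-moveToFront-rises x≢u rewrite rank-tail (removeItem u L) (≢-sym x≢u) =
    rank-removeItem-< (proj₂ recency u) x≢u

-- Occupied servers and the ranks on a full level.

server : ∀ {n} s → 1 ≤ s → s ≤ n → Fin n
server (suc s) _ s<n = fromℕ< s<n

server-injective : ∀ {n s t} {1≤s : 1 ≤ s} {s≤n : s ≤ n} {1≤t : 1 ≤ t} {t≤n : t ≤ n} →
                   server s 1≤s s≤n ≡ server t 1≤t t≤n → s ≡ t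
server-injective {s = suc s} {suc t} {s≤n = s<n} {t≤n = t<n} eq =
  cong suc (Finₚ.fromℕ<-injective s t s<n t<n eq)

-- Pigeonhole: an empty server `s` together with the `n` servers in use would give `n + 1` distinct
-- servers among `n`.
hosts : ∀ {n} {p : Config n} → ValidConfig p → ∀ {s} → 1 ≤ s → s ≤ n → ∃[ u ] p u ≡ s
hosts {n} {p} (range , inj) {s} 1≤s s≤n with any? (λ u → p u ≟ s)
... | yes hosted = hosted
... | no ¬hosted = contradiction (injective⇒≤ {f = f} f-injective) 1+n≰n
  where
  f : Fin (suc n) → Fin n
  f Fin.zero    = server s 1≤s s≤n
  f (Fin.suc u) = server (p u) (proj₁ (range u)) (proj₂ (range u))
  f-injective : ∀ {u v} → f u ≡ f v → u ≡ v
  f-injective {Fin.zero}  {Fin.zero}  _  = refl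
  f-injective {Fin.zero}  {Fin.suc v} eq = contradiction (v , sym (server-injective eq)) ¬hosted
  f-injective {Fin.suc u} {Fin.zero}  eq = contradiction (u , server-injective eq) ¬hosted
  f-injective {Fin.suc u} {Fin.suc v} eq = cong Fin.suc (inj u v (server-injective eq))

-- Pigeonhole: the 2^k items on a full level k have distinct positive ranks.
level-rank : ∀ {n} {p : Config n} {L} → ValidConfig p → RecencyList L →
  ∀ {k R} → 2 ^ suc k ≤ suc n →
  (∀ w → depth (p w) ≡ k → rankOf L w ≤ R) → 2 ^ k ≤ R
level-rank {n} {p} {L} valid (_ , complete) {k} {R} full bound = injective⇒≤ {f = f} f-injective
  where
  open ≤-Reasoning
  slot : Fin (2 ^ k) → ℕ
  slot t = 2 ^ k + toℕ t
  slot< : ∀ t → slot t < 2 ^ suc k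
  slot< t = begin-strict
    2 ^ k + toℕ t       <⟨ +-monoʳ-< (2 ^ k) (Finₚ.toℕ<n t) ⟩
    2 ^ k + 2 ^ k       ≡⟨ cong (2 ^ k +_) (+-identityʳ (2 ^ k)) ⟨
    2 ^ suc k           ∎
  slot-depth : ∀ t → depth (slot t) ≡ k
  slot-depth t = ≤-antisym
    (≮⇒≥ λ k<d → <⇒≱ (slot< t) (k≤log⇒2^k≤ (suc k) (≤-trans (1≤2^ k) (m≤m+n _ _)) k<d))
    (2^k≤⇒k≤log k (m≤m+n (2 ^ k) (toℕ t)))
  item : ∀ t → ∃[ w ] p w ≡ slot t
  item t = hosts valid (≤-trans (1≤2^ k) (m≤m+n _ _)) (s≤s⁻¹ (≤-trans (slot< t) full))
  w : Fin (2 ^ k) → Fin n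
  w t = proj₁ (item t)
  f : Fin (2 ^ k) → Fin R
  f t = server (rankOf L (w t)) (1≤rank L (w t))
          (bound (w t) (trans (cong depth (proj₂ (item t))) (slot-depth t)))
  f-injective : ∀ {s t} → f s ≡ f t → s ≡ t
  f-injective {s} {t} eq = Finₚ.toℕ-injective (+-cancelˡ-≡ (2 ^ k) _ _ (begin-equality
    slot s    ≡⟨ proj₂ (item s) ⟨
    p (w s)   ≡⟨ cong p (rank-injective (complete (w s)) (server-injective eq)) ⟩
    p (w t)   ≡⟨ proj₂ (item t) ⟩
    slot t    ∎))

-- The partner chosen by Move-Half.

HighestAt : ∀ {n} → Config n → ℕ → List (Fin n) → Maybe (Fin n) → Set
HighestAt p k L nothing  = ∀ w → w ∈ L → depth (p w) ≢ k
HighestAt p k L (just v) = v ∈ L × depth (p v) ≡ k ×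
                           (∀ w → w ∈ L → depth (p w) ≡ k → rankOf L w ≤ rankOf L v)

-- The list is ordered by rank, so the search prefers an answer from the tail. Uniqueness makes
-- ranks in the tail shift by exactly one.
highestRankAt-correct : ∀ {n} (p : Config n) k {L} → Unique L → HighestAt p k L (highestRankAt p k L)
highestRankAt-correct p k [] w ()
highestRankAt-correct p k {x ∷ L} (x∉L ∷ uniq)
  with highestRankAt p k L | highestRankAt-correct p k uniq
... | just v | v∈L , depth≡k , highest = there v∈L , depth≡k , highest′
  where
  highest′ : ∀ w → w ∈ x ∷ L → depth (p w) ≡ k → rankOf (x ∷ L) w ≤ rankOf (x ∷ L) v
  highest′ w (here refl) _ rewrite rank-head L x = 1≤rank (x ∷ L) v
  highest′ w (there w∈L) e
    rewrite rank-tail L (All.lookup x∉L w∈L) | rank-tail L (All.lookup x∉L v∈L) =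
    s≤s (highest w w∈L e)
... | nothing | none with depth (p x) ≟ k
...   | yes e rewrite dec-true (depth (p x) ≟ k) e = here refl , e , λ where
          w (here refl) _   → ≤-refl
          w (there w∈L) e′ → contradiction e′ (none w w∈L)
...   | no ≢k rewrite dec-false (depth (p x) ≟ k) ≢k = λ where
          w (here refl) → ≢k
          w (there w∈L) → none w w∈L

half+half≤ : ∀ d → ⌊ d /2⌋ + ⌊ d /2⌋ ≤ d
half+half≤ d = ≤-trans (+-monoʳ-≤ ⌊ d /2⌋ (⌊n/2⌋≤⌈n/2⌉ d)) (≤-reflexive (⌊n/2⌋+⌈n/2⌉≡n d))

≤1+half+half : ∀ d → d ≤ suc (⌊ d /2⌋ + ⌊ d /2⌋)
≤1+half+half 0 = z≤n
≤1+half+half 1 = ≤-refl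
≤1+half+half (suc (suc d)) = s≤s (s≤s
  (≤-trans (≤1+half+half d) (≤-reflexive (sym (+-suc ⌊ d /2⌋ ⌊ d /2⌋)))))

-- Level `k` is full when 2^(k+1) - 1 ≤ n. For positive depth, the level at half the depth lies
-- strictly above an occupied one; for depth 0 it is the root.
level-half-full : ∀ {n h} → 1 ≤ h → h ≤ n → 2 ^ suc ⌊ depth h /2⌋ ≤ suc n
level-half-full {n} {h} 1≤h h≤n with depth h in eq
... | zero  = s≤s (≤-trans 1≤h h≤n)
... | suc d = begin
  2 ^ suc ⌊ suc d /2⌋ ≤⟨ ^-monoʳ-≤ 2 (⌊n/2⌋<n d) ⟩
  2 ^ suc d           ≤⟨ k≤log⇒2^k≤ (suc d) 1≤h (≤-reflexive (sym eq)) ⟩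
  h                   ≤⟨ m≤n⇒m≤1+n h≤n ⟩
  suc n               ∎
  where open ≤-Reasoning

record MoveHalf {n} (p : Config n) (L : List (Fin n)) (u : Fin n) : Set where
  field
    partner       : Fin n
    swaps≡        : mhSwaps p L u ≡ interchangeSwaps (p u) (p partner)
    partner-depth : depth (p partner) ≡ ⌊ depth (p u) /2⌋
    partner-rank  : 2 ^ ⌊ depth (p u) /2⌋ ≤ rankOf L partner

moveHalf : ∀ {n} {p : Config n} {L} → ValidConfig p → RecencyList L → ∀ u → MoveHalf p L u
moveHalf {n} {p} {L} valid recency@(uniq , complete) u
  with highestRankAt p ⌊ depth (p u) /2⌋ L in eq
     | highestRankAt-correct p ⌊ depth (p u) /2⌋ uniq
-- On an empty level every rank would vacuously be at most 0, against `level-rank`.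
... | nothing | none = contradiction
        (level-rank valid recency {R = 0} full λ w e → contradiction e (none w (complete w)))
        (<⇒≱ (1≤2^ ⌊ depth (p u) /2⌋))
  where full = level-half-full (proj₁ (proj₁ valid u)) (proj₂ (proj₁ valid u))
... | just v | v∈L , depth≡ , highest = record
  { partner       = v
  ; swaps≡        = swaps≡
  ; partner-depth = depth≡
  ; partner-rank  = level-rank valid recency full λ w → highest w (complete w)
  }
  where
  full = level-half-full (proj₁ (proj₁ valid u)) (proj₂ (proj₁ valid u))
  swaps≡ : mhSwaps p L u ≡ interchangeSwaps (p u) (p v)
  swaps≡ rewrite eq = refl

-- Amortized cost of Move-Half.

log-rank : ∀ {n} → List (Fin n) → Fin n → ℕ
log-rank L x = ⌊log₂ rankOf L x ⌋

logRanks : ∀ {n} → List (Fin n) → List (Fin n) → ℕ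
logRanks L []      = 0
logRanks L (u ∷ σ) = log-rank L u + logRanks (moveToFront u L) σ

excess : ∀ {n} → Config n → List (Fin n) → Fin n → ℕ
excess p L x = depth (p x) ∸ 2 * log-rank L x

-- The overshoot d ∸ 2 (k ⊔ 1) bounds the excess of the item that is moved down to depth d.
half-amortized : ∀ d → d + 3 * (⌊ d /2⌋ + (d ∸ 2 * (⌊ d /2⌋ ⊔ 1))) ≤ 3 * d
half-amortized 0 = z≤n
half-amortized 1 = s≤s z≤n
half-amortized d@(suc (suc m)) = subst (λ e → e + 3 * (k + o) ≤ 3 * e) o+2k≡d (linear o≤k (identity k o))
  where
  k = ⌊ d /2⌋
  o = d ∸ 2 * (k ⊔ 1)
  identity : ∀ k o → (o + 2 * k) + 3 * (k + o) + k ≡ 3 * (o + 2 * k) + o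
  identity = solve-∀
  2k≡ : 2 * (k ⊔ 1) ≡ 2 * k
  2k≡ = cong (2 *_) (m≥n⇒m⊔n≡m {k} (s≤s z≤n))
  o+2k≡d : o + 2 * k ≡ d
  o+2k≡d = trans (cong (λ e → d ∸ e + 2 * k) 2k≡)
                 (m∸n+n≡m (subst (_≤ d) (cong (k +_) (sym (+-identityʳ k))) (half+half≤ d)))
  o≤k : o ≤ k
  o≤k = ≤-trans (m≤n+o⇒m∸n≤o d (2 * (k ⊔ 1)) (begin
    d                   ≤⟨ ≤1+half+half d ⟩
    suc (k + k)         ≡⟨ identity′ k ⟩
    2 * k + 1           ≡⟨ cong (_+ 1) 2k≡ ⟨
    2 * (k ⊔ 1) + 1     ∎)) (s≤s z≤n)
    where
    open ≤-Reasoning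
    identity′ : ∀ k → suc (k + k) ≡ 2 * k + 1
    identity′ = solve-∀

module _ {n} {p : Config n} {L : List (Fin n)} (valid : ValidConfig p) (recency : RecencyList L)
         (u : Fin n) where

  open MoveHalf (moveHalf valid recency u)

  private
    p′ = applySwaps (mhSwaps p L u) p
    L′ = moveToFront u L
    d  = depth (p u)
    k  = ⌊ d /2⌋
    interchanges : Interchanges (p u) (p partner) (mhSwaps p L u)
    interchanges = subst (Interchanges (p u) (p partner)) (sym swaps≡)
      (interchangeSwaps-correct (proj₁ (proj₁ valid u)) (proj₁ (proj₁ valid partner)))

    p′≗τ : p′ ≗ swapSrv (p u) (p partner) p
    p′≗τ x = trans (applySwaps≗act (mhSwaps p L u) p x) (proj₁ interchanges (p x))

  Valid-moveHalf : ValidConfig p′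
  Valid-moveHalf = Valid-resp-≗ p′≗τ
    (Valid-swapSrv (proj₁ (proj₁ valid u)) (proj₂ (proj₁ valid u))
                   (proj₁ (proj₁ valid partner)) (proj₂ (proj₁ valid partner)) valid)

  -- The path through the root has length at most `d + k`, is traversed at most twice, and
  -- `2 * k ≤ d`.
  moveHalf-swaps-≤ : length (mhSwaps p L u) ≤ 3 * d
  moveHalf-swaps-≤ = begin
    length (mhSwaps p L u)                        ≤⟨ proj₂ interchanges ⟩
    (d + depth (p partner)) + (d + depth (p partner)) ≡⟨ cong (λ e → (d + e) + (d + e)) partner-depth ⟩
    (d + k) + (d + k)                             ≤⟨ linear (half+half≤ d) (identity d k) ⟩
    3 * d                                         ∎
    where
    open ≤-Reasoning
    identity : ∀ d k → (d + k) + (d + k) + d ≡ 3 * d + (k + k)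
    identity = solve-∀

  private
    overshoot = d ∸ 2 * (k ⊔ 1)

    -- The partner comes from a full level, so its rank is at least `2 ^ k`; once another item is in
    -- front, it is also at least 2. The second bound gives the `⊔ 1`, which `half-amortized` needs
    -- at `d = 1`.
    excess-partner : u ≢ partner → excess p′ L′ partner ≤ overshoot
    excess-partner u≢v = begin
      depth (p′ partner) ∸ 2 * log-rank L′ partner
        ≡⟨ cong (λ s → depth s ∸ 2 * log-rank L′ partner)
             (trans (p′≗τ partner) (τ-right (p u) (p partner))) ⟩
      d ∸ 2 * log-rank L′ partner
        ≤⟨ ∸-monoʳ-≤ d (*-monoʳ-≤ 2 (⊔-lub k≤log 1≤log)) ⟩
      overshoot ∎
      where
      open ≤-Reasoning
      k≤log : k ≤ log-rank L′ partner
      k≤log = 2^k≤⇒k≤log k (≤-trans partner-rank (rank-moveToFront-≥ recency (≢-sym u≢v)))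
      1≤log : 1 ≤ log-rank L′ partner
      1≤log = 2^k≤⇒k≤log 1 (rank-moveToFront-≥2 recency (≢-sym u≢v))

    -- The `δ` terms express without subtraction that the excess of `u` falls from at least
    -- `d ∸ 2 * log-rank L u` to at most `k`. The partner gains at most `overshoot`; every other
    -- item keeps its server and its rank does not fall. If `u` is its own partner, the first case
    -- applies.
    excess-step : ∀ x → excess p′ L′ x + δ u d x ≤
                        excess p L x + (δ u (k + 2 * log-rank L u) x + δ partner overshoot x)
    excess-step x = step (x Finₚ.≟ u) (x Finₚ.≟ partner)
      where
      step : Dec (x ≡ u) → Dec (x ≡ partner) → excess p′ L′ x + δ u d x ≤
             excess p L x + (δ u (k + 2 * log-rank L u) x + δ partner overshoot x)
      step (yes refl) _ = begin
        excess p′ L′ u + δ u d u            ≤⟨ +-mono-≤ excess≤k (≤-reflexive (δ-≡ u d)) ⟩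
        k + d                               ≤⟨ +-monoʳ-≤ k (m≤n+m∸n d ℓ) ⟩
        k + (ℓ + excess p L u)              ≡⟨ identity k ℓ (excess p L u) ⟩
        excess p L u + (k + ℓ)              ≡⟨ cong (excess p L u +_) (δ-≡ u (k + ℓ)) ⟨
        excess p L u + δ u (k + ℓ) u        ≤⟨ +-monoʳ-≤ (excess p L u) (m≤m+n _ _) ⟩
        excess p L u + (δ u (k + ℓ) u + δ partner overshoot u) ∎
        where
        open ≤-Reasoning
        ℓ = 2 * log-rank L u
        identity : ∀ k ℓ e → k + (ℓ + e) ≡ e + (k + ℓ)
        identity = solve-∀
        excess≤k : excess p′ L′ u ≤ k
        excess≤k = ≤-trans (m∸n≤m _ (2 * log-rank L′ u))
          (≤-reflexive (trans (cong depth (trans (p′≗τ u) (τ-left (p u) (p partner)))) partner-depth))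
      step (no x≢u) (yes refl) = begin
        excess p′ L′ x + δ u d x   ≤⟨ +-mono-≤ (excess-partner (≢-sym x≢u)) (≤-reflexive (δ-≢ d x≢u)) ⟩
        overshoot + 0              ≡⟨ +-identityʳ overshoot ⟩
        overshoot                  ≡⟨ δ-≡ x overshoot ⟨
        δ x overshoot x            ≤⟨ m≤n+m _ (δ u (k + 2 * log-rank L u) x) ⟩
        δ u (k + 2 * log-rank L u) x + δ x overshoot x ≤⟨ m≤n+m _ (excess p L x) ⟩
        excess p L x + (δ u (k + 2 * log-rank L u) x + δ x overshoot x) ∎
        where open ≤-Reasoning
      step (no x≢u) (no x≢v) = begin
        excess p′ L′ x + δ u d x  ≡⟨ trans (cong (excess p′ L′ x +_) (δ-≢ d x≢u)) (+-identityʳ _) ⟩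
        excess p′ L′ x            ≡⟨ cong (λ s → depth s ∸ 2 * log-rank L′ x)
                                       (trans (p′≗τ x) (τ-other (x≢u ∘ proj₂ valid x u)
                                                                (x≢v ∘ proj₂ valid x partner))) ⟩
        depth (p x) ∸ 2 * log-rank L′ x
                                  ≤⟨ ∸-monoʳ-≤ (depth (p x)) (*-monoʳ-≤ 2
                                       (⌊log₂⌋-mono-≤ (rank-moveToFront-≥ recency x≢u))) ⟩
        excess p L x              ≤⟨ m≤m+n _ _ ⟩
        excess p L x + (δ u (k + 2 * log-rank L u) x + δ partner overshoot x) ∎
        where open ≤-Reasoning

  -- Three times the summed `excess-step` plus `half-amortized`, in which the terms `k + overshoot`
  -- cancel.
  moveHalf-amortized : d + 3 * sum (excess p′ L′) ≤ 6 * log-rank L u + 3 * sum (excess p L)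
  moveHalf-amortized = linear
    (+-mono-≤ (half-amortized d) (*-monoʳ-≤ 3 total))
    (identity d (sum (excess p L)) (sum (excess p′ L′)) k (log-rank L u) overshoot)
    where
    total : sum (excess p′ L′) + d ≤ sum (excess p L) + ((k + 2 * log-rank L u) + overshoot)
    total = subst₂ _≤_
      (cong (sum (excess p′ L′) +_) (sum-δ u d))
      (cong (sum (excess p L) +_) (cong₂ _+_ (sum-δ u _) (sum-δ partner overshoot)))
      (sum-mono₃ {f = excess p′ L′} {g = δ u d} {f′ = excess p L} excess-step)
    identity : ∀ d e e′ k ℓ o →
      (d + 3 * e′) + (3 * d + 3 * (e + ((k + 2 * ℓ) + o))) ≡
      (6 * ℓ + 3 * e) + ((d + 3 * (k + o)) + 3 * (e′ + d))
    identity = solve-∀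

-- Access and swaps cost at most `4 * d`, so the constants are four times those of
-- `moveHalf-amortized`.
mhCost-≤-logRanks : ∀ {n} {p : Config n} {L} → ValidConfig p → RecencyList L → ∀ σ →
                    mhCost p L σ ≤ 24 * logRanks L σ + 12 * sum (excess p L)
mhCost-≤-logRanks _ _ [] = z≤n
mhCost-≤-logRanks {p = p} {L} valid recency (u ∷ σ) = linear
  (+-mono-≤ (moveHalf-swaps-≤ valid recency u)
    (+-mono-≤ (*-monoʳ-≤ 4 (moveHalf-amortized valid recency u))
      (mhCost-≤-logRanks (Valid-moveHalf valid recency u) (RecencyList-moveToFront u recency) σ)))
  (identity (depth (p u)) (length (mhSwaps p L u)) _
    (sum (excess p L)) (sum (excess (applySwaps (mhSwaps p L u) p) (moveToFront u L)))
    (log-rank L u) (logRanks (moveToFront u L) σ))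
  where
  identity : ∀ d s c e e′ ℓ r →
    (d + s + c) + (3 * d + (4 * (6 * ℓ + 3 * e) + (24 * r + 12 * e′))) ≡
    (24 * (ℓ + r) + 12 * e) + (s + (4 * (d + 3 * e′) + c))
  identity = solve-∀

-- The debt of Opt at one level.

bubble : ∀ {n} → List ℕ → Config n → Config n
bubble s = applySwaps (map (λ h → (h , ⌊ h /2⌋)) s)

Valid-bubble₁ : ∀ {n} {p : Config n} {h} → 2 ≤ h → h ≤ n → ValidConfig p →
                ValidConfig (swapSrv h ⌊ h /2⌋ p)
Valid-bubble₁ {h = h} 2≤h h≤n =
  Valid-swapSrv (≤-trans (n≤1+n 1) 2≤h) h≤n (1≤half 2≤h) (≤-trans (⌊n/2⌋≤n h) h≤n)

Valid-bubble : ∀ {n} {p : Config n} {s} → ValidSwapList n s → ValidConfig p → ValidConfig (bubble s p)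
Valid-bubble []                  valid = valid
Valid-bubble ((2≤h , h≤n) ∷ ok) valid = Valid-bubble ok (Valid-bubble₁ 2≤h h≤n valid)

module Level (i : ℕ) where

  -- Servers at depth at most `i` are those with index below `Q`. By computation `M` and `2 * M` are
  -- `2 ^ (2 + i)` and `2 ^ (3 + i)`, the thresholds used in `farRequests`.
  Q M : ℕ
  Q = 2 ^ suc i
  M = 2 * Q

  -- The cap bounds what one item crossing the boundary can add. Subtracting `M` makes the charge
  -- vanish up to rank `M`, so an MRU tree starts without debt.
  charge : ∀ {n} → List (Fin n) → Fin n → ℕ
  charge L x = M ⊓ (rankOf L x ∸ M)

  low : ∀ {n} → Config n → Fin n → ℕ
  low p x = 𝟙 (depth (p x) ≤? i)

  debt : ∀ {n} → Config n → List (Fin n) → ℕ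
  debt p L = sum (λ x → low p x * charge L x)

  crossings : List ℕ → ℕ
  crossings []      = 0
  crossings (h ∷ s) = 𝟙 (suc i ≟ depth h) + crossings s

  -- Only the item rising from `h` can become low, and only if `h` is at depth `i + 1`; it then
  -- brings a charge of at most `M`.
  debt-swap : ∀ {n} {p : Config n} L {h} → 2 ≤ h → ValidConfig p →
              debt (swapSrv h ⌊ h /2⌋ p) L ≤ debt p L + M * 𝟙 (suc i ≟ depth h)
  debt-swap {p = p} L {h} 2≤h (_ , inj) = begin
    debt p′ L
      ≤⟨ sum-mono pointwise ⟩
    sum (λ x → low p x * charge L x + 𝟙 (p x ≟ h) * c)
      ≡⟨ ∑-distrib-+ (λ x → low p x * charge L x) (λ x → 𝟙 (p x ≟ h) * c) ⟩
    debt p L + sum (λ x → 𝟙 (p x ≟ h) * c)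
      ≤⟨ +-monoʳ-≤ (debt p L) (sum-fibre-≤ inj h c) ⟩
    debt p L + c ∎
    where
    open ≤-Reasoning
    p′ = swapSrv h ⌊ h /2⌋ p
    c = M * 𝟙 (suc i ≟ depth h)

    raised : ∀ x → p x ≡ h → depth (p′ x) ≤ i →
             charge L x ≤ low p x * charge L x + 𝟙 (p x ≟ h) * c
    raised x px≡h le with depth h ≤? i
    ... | yes dh≤i = ≤-trans (≤-reflexive (sym (trans
            (cong (_* charge L x) (𝟙-yes (depth (p x) ≤? i) (subst (λ s → depth s ≤ i) (sym px≡h) dh≤i)))
            (*-identityˡ _)))) (m≤m+n _ _)
    ... | no dh≰i = ≤-trans (≤-trans (m⊓n≤m M _) (≤-reflexive (sym (trans
            (cong (_* c) (𝟙-yes (p x ≟ h) px≡h))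
            (trans (*-identityˡ c)
            (trans (cong (M *_) (𝟙-yes (suc i ≟ depth h) 1+i≡dh)) (*-identityʳ M)))))))
            (m≤n+m _ _)
      where
      1+i≡dh : suc i ≡ depth h
      1+i≡dh = ≤-antisym (≰⇒> dh≰i) (subst (_≤ suc i) (depth-half 2≤h)
        (s≤s (subst (λ s → depth s ≤ i) (trans (cong (τ h ⌊ h /2⌋) px≡h) (τ-left h ⌊ h /2⌋)) le)))

    sunk : ∀ x → depth (p x) ≤ depth (p′ x) → low p′ x * charge L x ≤ low p x * charge L x
    sunk x d≤d′ = *-monoˡ-≤ (charge L x)
      (𝟙-mono (depth (p′ x) ≤? i) (depth (p x) ≤? i) (≤-trans d≤d′))

    pointwise : ∀ x → low p′ x * charge L x ≤ low p x * charge L x + 𝟙 (p x ≟ h) * c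
    pointwise x with position h ⌊ h /2⌋ (p x)
    ... | left e = 𝟙*-≤ (depth (p′ x) ≤? i) (raised x e)
    ... | right e = ≤-trans (sunk x (subst₂ (λ s s′ → depth s ≤ depth s′) (sym e)
            (sym (trans (cong (τ h ⌊ h /2⌋) e) (τ-right h ⌊ h /2⌋)))
            (⌊log₂⌋-mono-≤ (⌊n/2⌋≤n h)))) (m≤m+n _ _)
    ... | other ≢h ≢h/2 = ≤-trans (sunk x (≤-reflexive (cong depth (sym (τ-other ≢h ≢h/2))))) (m≤m+n _ _)

  debt-bubble : ∀ {n} {p : Config n} L {s} → ValidSwapList n s → ValidConfig p →
                debt (bubble s p) L ≤ debt p L + M * crossings s
  debt-bubble {p = p} L [] valid =
    ≤-reflexive (sym (trans (cong (debt p L +_) (*-zeroʳ M)) (+-identityʳ _)))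
  debt-bubble {p = p} L {h ∷ s} ((2≤h , h≤n) ∷ ok) valid = linear
    (+-mono-≤ (debt-swap L 2≤h valid) (debt-bubble L ok (Valid-bubble₁ 2≤h h≤n valid)))
    (identity (debt (bubble (h ∷ s) p) L) (debt p L) (debt (swapSrv h ⌊ h /2⌋ p) L)
              M (𝟙 (suc i ≟ depth h)) (crossings s))
    where
    identity : ∀ e″ e e′ m a b →
      e″ + ((e + m * a) + (e′ + m * b)) ≡ (e + m * (a + b)) + (e′ + e″)
    identity = solve-∀

  module _ {n} {p : Config n} {L : List (Fin n)} (valid : ValidConfig p) (recency : RecencyList L)
           (u : Fin n) where

    private
      r = rankOf L u
      L′ = moveToFront u L
      far  = 𝟙 (2 * M ≤? r)
      near = 𝟙 (M ≤? r)
      deep = 𝟙 (i <? depth (p u))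

      1≤M : 1 ≤ M
      1≤M = 1≤2^ (suc (suc i))

      charge-front : charge L′ u ≡ 0
      charge-front rewrite rank-head (removeItem u L) u | m≤n⇒m∸n≡0 1≤M = ⊓-zeroʳ M

      -- If the rank rises, the new rank is at most `r`. For `r` below `M` the new charge is
      -- therefore zero; otherwise the rank, and so the charge, grows by at most one.
      charge-other : ∀ {x} → x ≢ u → charge L′ x ≤ charge L x + near
      charge-other {x} x≢u with rank-moveToFront-rises recency x≢u
      ... | inj₁ r′≤r = ≤-trans (⊓-monoʳ-≤ M (∸-monoˡ-≤ M r′≤r)) (m≤m+n _ _)
      ... | inj₂ r′≤ru with M ≤? r
      ...   | yes M≤r = begin
        M ⊓ (rankOf L′ x ∸ M)          ≤⟨ ⊓-monoʳ-≤ M (∸-monoˡ-≤ M (rank-moveToFront-≤ recency x≢u)) ⟩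
        M ⊓ (suc (rankOf L x) ∸ M)     ≤⟨ ⊓-monoʳ-≤ M (m≤n+o⇒m∸n≤o (suc (rankOf L x)) M
                                            (≤-trans (s≤s (m≤n+m∸n (rankOf L x) M))
                                                     (≤-reflexive (sym (+-suc M _))))) ⟩
        M ⊓ suc (rankOf L x ∸ M)       ≤⟨ ⊓-monoˡ-≤ (suc (rankOf L x ∸ M)) (n≤1+n M) ⟩
        suc M ⊓ suc (rankOf L x ∸ M)   ≡⟨ +-comm 1 (charge L x) ⟩
        charge L x + 1                 ≡⟨ cong (charge L x +_) (𝟙-yes (M ≤? r) M≤r) ⟨
        charge L x + near              ∎
        where open ≤-Reasoning
      ...   | no M≰r = ≤-trans (m⊓n≤n M _)
        (≤-trans (≤-reflexive (m≤n⇒m∸n≡0 (≤-trans r′≤ru (≰⇒≥ M≰r)))) z≤n)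

      -- An item of rank at least `2 * M` carries the full charge `M` if it is low; if it is not
      -- low, Opt pays for serving it below level `i`.
      requested : M * far ≤ low p u * charge L u + M * deep
      requested = ≤-trans (≤-reflexive (*-comm M far))
        (𝟙*-≤ (2 * M ≤? r) λ 2M≤r → by-depth 2M≤r (depth (p u) ≤? i))
        where
        by-depth : 2 * M ≤ r → Dec (depth (p u) ≤ i) → M ≤ low p u * charge L u + M * deep
        by-depth 2M≤r (yes d≤i) = begin
          M                      ≡⟨ m≤n⇒m⊓n≡m (m+n≤o⇒m≤o∸n M (subst (_≤ r) (cong (M +_) (+-identityʳ M)) 2M≤r)) ⟨
          charge L u             ≡⟨ *-identityˡ (charge L u) ⟨
          1 * charge L u         ≡⟨ cong (_* charge L u) (𝟙-yes (depth (p u) ≤? i) d≤i) ⟨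
          low p u * charge L u   ≤⟨ m≤m+n _ _ ⟩
          low p u * charge L u + M * deep ∎
          where open ≤-Reasoning
        by-depth _ (no d≰i) = begin
          M                      ≡⟨ *-identityʳ M ⟨
          M * 1                  ≡⟨ cong (M *_) (𝟙-yes (i <? depth (p u)) (≰⇒> d≰i)) ⟨
          M * deep               ≤⟨ m≤n+m _ _ ⟩
          low p u * charge L u + M * deep ∎
          where open ≤-Reasoning

      pointwise : ∀ x → low p x * charge L′ x + δ u (M * far) x ≤
                        low p x * charge L x + (low p x * near + δ u (M * deep) x)
      pointwise x = step (x Finₚ.≟ u)
        where
        open ≤-Reasoning
        step : Dec (x ≡ u) → low p x * charge L′ x + δ u (M * far) x ≤
                             low p x * charge L x + (low p x * near + δ u (M * deep) x)
        step (yes refl) = begin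
          low p u * charge L′ u + δ u (M * far) u
            ≡⟨ cong₂ _+_ (trans (cong (low p u *_) charge-front) (*-zeroʳ (low p u))) (δ-≡ u (M * far)) ⟩
          M * far
            ≤⟨ requested ⟩
          low p u * charge L u + M * deep
            ≡⟨ cong (low p u * charge L u +_) (δ-≡ u (M * deep)) ⟨
          low p u * charge L u + δ u (M * deep) u
            ≤⟨ +-monoʳ-≤ (low p u * charge L u) (m≤n+m _ (low p u * near)) ⟩
          low p u * charge L u + (low p u * near + δ u (M * deep) u) ∎
        step (no x≢u) = begin
          low p x * charge L′ x + δ u (M * far) x
            ≡⟨ trans (cong (low p x * charge L′ x +_) (δ-≢ (M * far) x≢u)) (+-identityʳ _) ⟩
          low p x * charge L′ x
            ≤⟨ *-monoʳ-≤ (low p x) (charge-other x≢u) ⟩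
          low p x * (charge L x + near)
            ≡⟨ *-distribˡ-+ (low p x) (charge L x) near ⟩
          low p x * charge L x + low p x * near
            ≤⟨ +-monoʳ-≤ (low p x * charge L x) (m≤m+n (low p x * near) _) ⟩
          low p x * charge L x + (low p x * near + δ u (M * deep) x) ∎

      few-low : sum (λ x → low p x * near) ≤ Q * near
      few-low = ≤-trans
        (sum-mono λ x → *-monoˡ-≤ near
          (𝟙-mono (depth (p x) ≤? i) (p x <? Q) (log≤⇒<2^ i)))
        (sum-below-≤ (proj₂ valid) Q near)

    debt-request : debt p L′ + M * far ≤ debt p L + (Q * near + M * deep)
    debt-request = begin
      debt p L′ + M * far
        ≡⟨ cong (debt p L′ +_) (sum-δ u (M * far)) ⟨
      debt p L′ + sum (δ u (M * far))
        ≤⟨ sum-mono₃ {f = λ x → low p x * charge L′ x} {g = δ u (M * far)}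
             {f′ = λ x → low p x * charge L x} {g′ = λ x → low p x * near} pointwise ⟩
      debt p L + (sum (λ x → low p x * near) + sum (δ u (M * deep)))
        ≤⟨ +-monoʳ-≤ (debt p L) (+-mono-≤ few-low (≤-reflexive (sum-δ u (M * deep)))) ⟩
      debt p L + (Q * near + M * deep) ∎
      where open ≤-Reasoning

-- Far requests counted along a schedule.

farRequests : ∀ {n} → ℕ → List (Fin n) → List (Fin n) → ℕ
farRequests k L []      = 0
farRequests k L (u ∷ σ) = 𝟙 (2 ^ k ≤? rankOf L u) + farRequests k (moveToFront u L) σ

-- In the notation of the overview, `farRequests k` is W k and `levelCost i` is Y i.
levelCost : ∀ {n} → ℕ → Config n → (σ : List (Fin n)) → Vec (List ℕ) (length σ) → ℕ
levelCost i p []      []       = 0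
levelCost i p (u ∷ σ) (s ∷ ss) =
  Level.crossings i s + 𝟙 (i <? depth (bubble s p u)) + levelCost i (bubble s p) σ ss

-- `debt-bubble` and `debt-request` are added along the schedule; the debts telescope and the final
-- one is dropped.
farRequests-amortized : ∀ {n} i {p : Config n} {L} → ValidConfig p → RecencyList L →
  ∀ σ {sched} → ValidSchedule n sched → let open Level i in
  M * farRequests (3 + i) L σ ≤ debt p L + (Q * farRequests (2 + i) L σ + M * levelCost i p σ sched)
farRequests-amortized i valid recency [] [] = ≤-trans (≤-reflexive (*-zeroʳ (Level.M i))) z≤n
farRequests-amortized i {p} {L} valid recency (u ∷ σ) {s ∷ ss} (ok ∷ oks) = linear
  (+-mono-≤ (debt-bubble L ok valid)
    (+-mono-≤ (debt-request valid′ recency u)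
      (farRequests-amortized i valid′ (RecencyList-moveToFront u recency) σ oks)))
  (identity M Q (𝟙 (2 * M ≤? rankOf L u)) (farRequests (3 + i) L′ σ)
    (debt p L) (debt p′ L) (debt p′ L′) (𝟙 (M ≤? rankOf L u)) (farRequests (2 + i) L′ σ)
    (crossings s) (𝟙 (i <? depth (p′ u))) (levelCost i p′ σ ss))
  where
  open Level i
  p′ = bubble s p
  L′ = moveToFront u L
  valid′ = Valid-bubble ok valid
  identity : ∀ m q f f′ e e₁ e₂ g g′ c h y →
    m * (f + f′) + ((e + m * c) + ((e₁ + (q * g + m * h)) + (e₂ + (q * g′ + m * y)))) ≡
    (e + (q * (g + g′) + m * ((c + h) + y))) + (e₁ + ((e₂ + m * f) + m * f′))
  identity = solve-∀

-- In an MRU tree an item at depth at most `i` has rank below `Q`, hence no charge.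
debt-MRU : ∀ {n} i {p : Config n} {L} → IsMRU p L → Level.debt i p L ≡ 0
debt-MRU i {p} {L} mru = sum-zero λ x → n≤0⇒n≡0 (𝟙*-≤ (depth (p x) ≤? i) λ d≤i →
  ≤-trans (m⊓n≤n M _) (≤-reflexive (m≤n⇒m∸n≡0 (begin
    rankOf L x   ≤⟨ <⇒≤ (log≤⇒<2^ i (subst (_≤ i) (mru x) d≤i)) ⟩
    Q            ≤⟨ m≤m+n Q _ ⟩
    M            ∎))))
  where
  open ≤-Reasoning
  open Level i

-- The initial debt is zero and `M = 2 * Q`, so `Q` cancels. The factor 2 on the left makes the
-- counts contract from level to level.
farRequests-≤-levelCost : ∀ {n} i {p : Config n} {L} → ValidConfig p → RecencyList L → IsMRU p L →
  ∀ σ {sched} → ValidSchedule n sched →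
  2 * farRequests (3 + i) L σ ≤ farRequests (2 + i) L σ + 2 * levelCost i p σ sched
farRequests-≤-levelCost i {p} {L} valid recency mru σ {sched} oks =
  *-cancelˡ-≤ Q {{m^n≢0 2 (suc i)}} (begin
    Q * (2 * a)           ≡⟨ identity₁ Q a ⟩
    M * a                 ≤⟨ farRequests-amortized i valid recency σ oks ⟩
    debt p L + (Q * b + M * c) ≡⟨ cong (_+ (Q * b + M * c)) (debt-MRU i {p} {L} mru) ⟩
    Q * b + M * c         ≡⟨ identity₂ Q b c ⟩
    Q * (b + 2 * c)       ∎)
  where
  open ≤-Reasoning
  open Level i
  a = farRequests (3 + i) L σ
  b = farRequests (2 + i) L σ
  c = levelCost i p σ sched
  identity₁ : ∀ q a → q * (2 * a) ≡ (2 * q) * a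
  identity₁ = solve-∀
  identity₂ : ∀ q b c → q * b + (2 * q) * c ≡ q * (b + 2 * c)
  identity₂ = solve-∀

-- Positive when the last requested item has left the root; this pays for a request of rank at least 2
-- that Opt serves at the root.
stale : ∀ {n} → Config n → List (Fin n) → ℕ
stale p []      = 0
stale p (x ∷ _) = 𝟙 (1 ≤? depth (p x))

-- `stale` is at most one, so any single swap pays for its increase.
stale-bubble : ∀ {n} (p : Config n) L s → stale (bubble s p) L ≤ stale p L + length s
stale-bubble p []      s       = z≤n
stale-bubble p (x ∷ L) []      = m≤m+n _ _
stale-bubble p (x ∷ L) (h ∷ s) =
  ≤-trans (𝟙-≤ (1 ≤? depth (bubble (h ∷ s) p x)) λ _ → s≤s z≤n) (m≤n+m _ (stale p (x ∷ L)))

-- A repeated request has rank 1 and leaves `stale` unchanged. Otherwise, if `u` is at the root, the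
-- previous front item is not, and the old `stale` pays; if `u` is deeper, `2 * depth (p u)` pays
-- for both indicators.
stale-request : ∀ {n} {p : Config n} {L} → ValidConfig p → RecencyList L → ∀ u →
  𝟙 (2 ≤? rankOf L u) + stale p (moveToFront u L) ≤ stale p L + 2 * depth (p u)
stale-request {L = []} _ (_ , complete) u with () ← complete u
stale-request {p = p} {x ∷ L} (range , inj) _ u = step (x Finₚ.≟ u) (depth (p u)) refl
  where
  step : Dec (x ≡ u) → ∀ d → depth (p u) ≡ d →
         𝟙 (2 ≤? rankOf (x ∷ L) u) + 𝟙 (1 ≤? depth (p u)) ≤ 𝟙 (1 ≤? depth (p x)) + 2 * depth (p u)
  step (yes refl) _ _ rewrite rank-head L x = m≤m+n _ _
  step (no x≢u) zero du≡0 rewrite du≡0 = +-monoˡ-≤ 0 (≤-trans (𝟙-≤ (2 ≤? rankOf (x ∷ L) u) (λ _ → ≤-refl))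
    (≤-reflexive (sym (𝟙-yes (1 ≤? depth (p x)) (n≢0⇒n>0 λ dx≡0 → x≢u (inj x u
      (trans (depth≡0⇒≡1 (proj₁ (range x)) dx≡0) (sym (depth≡0⇒≡1 (proj₁ (range u)) du≡0)))))))))
  step (no x≢u) (suc d) du≡1+d = ≤-trans
    (+-mono-≤ (𝟙-≤ (2 ≤? rankOf (x ∷ L) u) (λ _ → ≤-refl)) (𝟙-≤ (1 ≤? depth (p u)) (λ _ → ≤-refl)))
    (≤-trans (*-monoʳ-≤ 2 (subst (1 ≤_) (sym du≡1+d) (s≤s z≤n))) (m≤n+m _ (𝟙 (1 ≤? depth (p x)))))

farRequests₁-≤-offCost : ∀ {n} {p : Config n} {L} → ValidConfig p → RecencyList L →
  ∀ σ {sched} → ValidSchedule n sched → farRequests 1 L σ ≤ stale p L + 2 * offCost p σ sched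
farRequests₁-≤-offCost valid recency [] [] = z≤n
farRequests₁-≤-offCost {p = p} {L} valid recency (u ∷ σ) {s ∷ ss} (ok ∷ oks) = linear
  -- The right-hand side contains `length s` twice, but `stale-bubble` uses it once; this discards
  -- the other copy.
  (+-mono-≤ (z≤n {length s}) (+-mono-≤ (stale-bubble p L s)
    (+-mono-≤ (stale-request valid′ recency u)
      (farRequests₁-≤-offCost valid′ (RecencyList-moveToFront u recency) σ oks))))
  (identity (𝟙 (2 ≤? rankOf L u)) (farRequests 1 L′ σ) (stale p L) (stale p′ L) (stale p′ L′)
    (length s) (depth (p′ u)) (offCost p′ σ ss))
  where
  p′ = bubble s p
  L′ = moveToFront u L
  valid′ = Valid-bubble ok valid
  identity : ∀ f f′ e e₁ e₂ s d c →
    (f + f′) + (s + ((e + s) + ((e₁ + 2 * d) + (e₂ + 2 * c)))) ≡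
    (e + 2 * ((s + d) + c)) + (0 + (e₁ + ((f + e₂) + f′)))
  identity = solve-∀

-- Summation over the levels.

farRequests-antitone : ∀ {n} k (L : List (Fin n)) σ → farRequests (suc k) L σ ≤ farRequests k L σ
farRequests-antitone k L []      = z≤n
farRequests-antitone k L (u ∷ σ) = +-mono-≤
  (𝟙-mono (2 ^ suc k ≤? rankOf L u) (2 ^ k ≤? rankOf L u) (≤-trans (^-monoʳ-≤ 2 (n≤1+n k))))
  (farRequests-antitone k (moveToFront u L) σ)

-- The depth of the child determines the only boundary that a swap crosses.
sum-crossings-≤ : ∀ N s → sum {N} (λ i → Level.crossings (toℕ i) s) ≤ length s
sum-crossings-≤ N []      = ≤-reflexive (sum-zero {N} λ _ → refl)
sum-crossings-≤ N (h ∷ s) = begin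
  sum {N} (λ i → crossing i + Level.crossings (toℕ i) s)
    ≡⟨ ∑-distrib-+ crossing (λ i → Level.crossings (toℕ i) s) ⟩
  sum {N} crossing + sum {N} (λ i → Level.crossings (toℕ i) s)
    ≤⟨ +-mono-≤ once (sum-crossings-≤ N s) ⟩
  suc (length s) ∎
  where
  open ≤-Reasoning
  crossing : Fin N → ℕ
  crossing i = 𝟙 (suc (toℕ i) ≟ depth h)
  once : sum crossing ≤ 1
  once = ≤-trans (sum-mono λ i → ≤-reflexive (sym (*-identityʳ (crossing i))))
    (sum-fibre-≤ {N} {suc ∘ toℕ} (λ i j eq → Finₚ.toℕ-injective (suc-injective eq)) (depth h) 1)

sum-<-≤ : ∀ N d → sum {N} (λ i → 𝟙 (toℕ i <? d)) ≤ d
sum-<-≤ N d = ≤-trans (sum-mono {N} λ i → ≤-reflexive (sym (*-identityʳ (𝟙 (toℕ i <? d)))))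
  (≤-trans (sum-below-≤ {N} {toℕ} (λ _ _ → Finₚ.toℕ-injective) d 1) (≤-reflexive (*-identityʳ d)))

≤-sum-< : ∀ {N d} → d ≤ N → d ≤ sum {N} (λ i → 𝟙 (toℕ i <? d))
≤-sum-< z≤n       = z≤n
≤-sum-< (s≤s d≤N) = s≤s (≤-sum-< d≤N)

sum-levelCost-≤ : ∀ {n} N (p : Config n) σ sched →
                  sum {N} (λ i → levelCost (toℕ i) p σ sched) ≤ offCost p σ sched
sum-levelCost-≤ N p []      []       = ≤-reflexive (sum-zero {N} λ _ → refl)
sum-levelCost-≤ N p (u ∷ σ) (s ∷ ss) = begin
  sum {N} (λ i → cross i + deep i + rest i)
    ≡⟨ ∑-distrib-+ (λ i → cross i + deep i) rest ⟩
  sum {N} (λ i → cross i + deep i) + sum rest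
    ≡⟨ cong (_+ sum rest) (∑-distrib-+ cross deep) ⟩
  sum cross + sum deep + sum rest
    ≤⟨ +-mono-≤ (+-mono-≤ (sum-crossings-≤ N s) (sum-<-≤ N (depth (bubble s p u))))
                (sum-levelCost-≤ N (bubble s p) σ ss) ⟩
  offCost p (u ∷ σ) (s ∷ ss) ∎
  where
  open ≤-Reasoning
  cross deep rest : Fin N → ℕ
  cross i = Level.crossings (toℕ i) s
  deep  i = 𝟙 (toℕ i <? depth (bubble s p u))
  rest  i = levelCost (toℕ i) (bubble s p) σ ss

-- The logarithm of a rank counts the `k` with `2 ^ suc k` at most that rank. The hypothesis on `N`
-- ensures that the truncated sum misses no such `k`.
logRanks-≤-sum : ∀ {n} N (L : List (Fin n)) σ → logRanks L σ ≤ N →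
                 logRanks L σ ≤ sum {N} (λ k → farRequests (suc (toℕ k)) L σ)
logRanks-≤-sum N L []      _  = z≤n
logRanks-≤-sum N L (u ∷ σ) ≤N = begin
  log-rank L u + logRanks L′ σ
    ≤⟨ +-mono-≤ (≤-trans (≤-sum-< (≤-trans (m≤m+n _ _) ≤N)) (sum-mono {N} λ k →
         𝟙-mono (toℕ k <? log-rank L u) (2 ^ suc (toℕ k) ≤? rankOf L u)
           (k≤log⇒2^k≤ (suc (toℕ k)) (1≤rank L u))))
       (logRanks-≤-sum N L′ σ (≤-trans (m≤n+m _ (log-rank L u)) ≤N)) ⟩
  sum {N} (λ k → 𝟙 (2 ^ suc (toℕ k) ≤? rankOf L u)) + sum {N} (λ k → farRequests (suc (toℕ k)) L′ σ)
    ≡⟨ ∑-distrib-+ {N} _ _ ⟨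
  sum {N} (λ k → farRequests (suc (toℕ k)) L (u ∷ σ)) ∎
  where
  open ≤-Reasoning
  L′ = moveToFront u L

-- The shifted sum has one extra term at its end, which only enlarges the right-hand side.
sum-shift-≤ : ∀ N (f : ℕ → ℕ) → sum {N} (f ∘ toℕ) ≤ f 0 + sum {N} (f ∘ suc ∘ toℕ)
sum-shift-≤ zero    f = z≤n
sum-shift-≤ (suc N) f = +-monoʳ-≤ (f 0) (sum-shift-≤ N (f ∘ suc))

logRanks-≤-offCost : ∀ {n} {p : Config n} {L} → ValidConfig p → RecencyList L → IsMRU p L →
  ∀ σ {sched} → ValidSchedule n sched → logRanks L σ ≤ 8 * offCost p σ sched
logRanks-≤-offCost {p = p} {L} valid recency mru σ {sched} oks = combine
  (logRanks-≤-sum N L σ ≤-refl) (sum-shift-≤ N (λ k → W (1 + k))) (sum-shift-≤ N (λ k → W (2 + k)))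
  levels (sum-levelCost-≤ N p σ sched) (farRequests-antitone 1 L σ) W₁≤
  where
  open ≤-Reasoning
  N = logRanks L σ
  W : ℕ → ℕ
  W k = farRequests k L σ
  S : ℕ → ℕ
  S j = sum {N} (λ k → W (j + toℕ k))

  -- The front item has rank 1, so an MRU tree keeps it at the root.
  not-stale : ∀ L → IsMRU p L → stale p L ≡ 0
  not-stale []      _   = refl
  not-stale (x ∷ L) mru rewrite mru x | rank-head L x = refl

  W₁≤ : W 1 ≤ 2 * offCost p σ sched
  W₁≤ = ≤-trans (farRequests₁-≤-offCost valid recency σ oks)
    (≤-reflexive (cong (_+ 2 * offCost p σ sched) (not-stale L mru)))

  Y : Fin N → ℕ
  Y i = levelCost (toℕ i) p σ sched

  levels : S 3 + S 3 ≤ S 2 + (sum Y + sum Y)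
  levels = sum-mono₃ {f = λ k → W (3 + toℕ k)} {g = λ k → W (3 + toℕ k)}
                     {f′ = λ k → W (2 + toℕ k)} {g′ = Y} {h′ = Y}
    λ i → subst₂ (λ a b → a ≤ W (2 + toℕ i) + b)
      (cong (W (3 + toℕ i) +_) (+-identityʳ _)) (cong (Y i +_) (+-identityʳ _))
      (farRequests-≤-levelCost (toℕ i) valid recency mru σ oks)

  -- The bounds on `s₂` and `s₃` give `s₂ ≤ 2 * w₂ + 2 * y`, so `ℓ ≤ w₁ + 2 * w₂ + 2 * y ≤ 3 * w₁ +
  -- 2 * c ≤ 8 * c`.
  combine : ∀ {ℓ s₁ s₂ s₃ y w₁ w₂ c} → ℓ ≤ s₁ → s₁ ≤ w₁ + s₂ → s₂ ≤ w₂ + s₃ →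
            s₃ + s₃ ≤ s₂ + (y + y) → y ≤ c → w₂ ≤ w₁ → w₁ ≤ 2 * c → ℓ ≤ 8 * c
  combine {ℓ} {s₁} {s₂} {s₃} {y} {w₁} {w₂} {c} h₁ h₂ h₃ h₄ h₅ h₆ h₇ = linear
    (+-mono-≤ h₁ (+-mono-≤ h₂ (+-mono-≤ (*-monoʳ-≤ 2 h₃) (+-mono-≤ h₄ (+-mono-≤ (*-monoʳ-≤ 2 h₅)
      (+-mono-≤ (*-monoʳ-≤ 2 h₆) (*-monoʳ-≤ 3 h₇)))))))
    (identity ℓ s₁ s₂ s₃ y w₁ w₂ c)
    where
    identity : ∀ ℓ s₁ s₂ s₃ y w₁ w₂ c →
      ℓ + (s₁ + ((w₁ + s₂) + (2 * (w₂ + s₃) + ((s₂ + (y + y)) + (2 * c + (2 * w₁ + 3 * (2 * c))))))) ≡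
      8 * c + (ℓ + (s₁ + (2 * s₂ + ((s₃ + s₃) + (2 * y + (2 * w₂ + 3 * w₁))))))
    identity = solve-∀

-- Comparison of the two costs from an MRU tree.

excess-MRU : ∀ {n} {p : Config n} {L} → IsMRU p L → sum (excess p L) ≡ 0
excess-MRU {p = p} {L} mru = sum-zero λ x →
  m≤n⇒m∸n≡0 (≤-trans (≤-reflexive (mru x)) (m≤m+n (log-rank L x) _))

↭-allFin⇒RecencyList : ∀ {n} {L : List (Fin n)} → L ↭ allFin n → RecencyList L
↭-allFin⇒RecencyList {n} L↭ =
  PermutationSetoid.Unique-resp-↭ (setoid (Fin n)) (↭⇒↭ₛ (↭-sym L↭)) (allFin⁺ n) ,
  λ u → ∈-resp-↭ (↭-sym L↭) (∈-allFin u)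

theorem2 : ∃[ c ] ((n : ℕ) (p₀ : Config n) (L₀ : List (Fin n))
    → ValidConfig p₀ → L₀ ↭ allFin n → IsMRU p₀ L₀
    → (σ : List (Fin n)) (sched : Vec (List ℕ) (length σ))
    → ValidSchedule n sched
    → mhCost p₀ L₀ σ ≤ c * offCost p₀ σ sched)
-- The constant is 24 * 8: Move-Half costs at most 24 times the sum of the logarithms of the ranks,
-- which is at most 8 times the cost of any schedule.
theorem2 = 192 , λ n p₀ L₀ valid L₀↭ mru σ sched oks →
  let recency = ↭-allFin⇒RecencyList L₀↭
      open ≤-Reasoning
  in begin
    mhCost p₀ L₀ σ                                   ≤⟨ mhCost-≤-logRanks valid recency σ ⟩
    24 * logRanks L₀ σ + 12 * sum (excess p₀ L₀)     ≡⟨ cong (λ e → 24 * logRanks L₀ σ + 12 * e)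
                                                          (excess-MRU {p = p₀} {L₀} mru) ⟩
    24 * logRanks L₀ σ + 0                           ≡⟨ +-identityʳ _ ⟩
    24 * logRanks L₀ σ                               ≤⟨ *-monoʳ-≤ 24 (logRanks-≤-offCost valid recency mru σ oks) ⟩
    24 * (8 * offCost p₀ σ sched)                    ≡⟨ *-assoc 24 8 (offCost p₀ σ sched) ⟨
    192 * offCost p₀ σ sched                         ∎
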